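{- For every positive integer $k$ there exists a point set $P=\{v_1,\ldots,v_k,v_{k+1}\}$ of $k+1$ vectors in a Euclidean space from which the greedy algorithm with parameter $k$ (for some way of breaking ties) picks $V=\{v_1,\ldots,v_k\}$, and $$\frac{\mathsf{vol}(V - v_1 + v_{k+1})}{\mathsf{vol}(V)} = \sqrt{k}.$$
   Context: For a finite set $S=\{u_1,\ldots,u_r\}$ of vectors in $\mathbb{R}^d$, $\mathsf{vol}(S)$ denotes the $r$-dimensional volume of the parallelepiped spanned by $S$, i.e. $\mathsf{vol}(S)^2 = \det\big(\langle u_a,u_b\rangle\big)_{a,b=1}^r$ (the Gram determinant), with $\mathsf{vol}(S)\ge 0$. The notation $V - v + w$ means $(V\setminus\{v\})\cup\{w\}$. Greedy algorithm: the input is a finite point set $P\subset\mathbb{R}^d$ and an integer $k$ (with $|P|\ge k$). Initialize $\mathcal{C}=\emptyset$. For $i=1,\ldots,k$, add to $\mathcal{C}$ a point $p\in P\setminus\mathcal{C}$ that maximizes $\mathsf{vol}(\mathcal{C}\cup\{p\})$; if there are several maximizers, any of them may be chosen. Return $\mathcal{C}$, a subset of $P$ of size $k$. -}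

module Defs where

open import Algebra.Bundles using (RawRing)
open import Data.Fin.Base using (Fin; zero; suc; toℕ; punchIn)
open import Data.Fin.Subset using (Subset; inside; outside; ⊥; ⁅_⁆; _∪_; _∉_; ∣_∣)
open import Data.Integer.Base as ℤ using (+_; -[1+_]; +<+)
import Data.Integer.Properties as ℤ
open import Data.Nat.Base as ℕ using (ℕ; zero; suc; z≤n; s≤s)
import Data.Nat.Coprimality as Coprimality
import Data.Nat.Properties as ℕ
open import Data.Product.Base using (∃; _×_; _,_)
open import Data.Rational.Base as ℚ using (ℚ; mkℚ; 0ℚ; 1ℚ; ↥_; ↧ₙ_; *≤*; *<*)
import Data.Rational.Properties as ℚ
open import Data.Rational.Solver using (module +-*-Solver)
import Data.Rational.Unnormalised.Base as ℚᵘ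
import Data.Rational.Unnormalised.Properties as ℚᵘ
open import Data.Sum.Base using (_⊎_; inj₁; inj₂)
open import Data.Vec.Base using ([]; _∷_)
open import Data.Vec.Functional using (Vector)
open import Function.Base using (_∘_; _$_)
open import Level using (0ℓ)
open import Relation.Binary.PropositionalEquality
open import Relation.Nullary.Decidable.Core using (yes; no)
open import Relation.Nullary.Negation.Core using (contradiction)

------------------------------------------------------------------------
-- Determinants

module Determinant {c ℓ} (R : RawRing c ℓ) where
  open RawRing R using (Carrier; _*_; -_; 1#; rawSemiring)
  open import Algebra.Definitions.RawSemiring rawSemiring using (sum; _^_)

  Matrix : ℕ → Set c
  Matrix n = Fin n → Fin n → Carrier

  -- Laplace expansion along the first row.
  det : ∀ {n} → Matrix n → Carrier
  det {zero}  M = 1#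
  det {suc n} M = sum λ j →
    (- 1#) ^ toℕ j * (M zero j * det λ a b → M (suc a) (punchIn j b))

------------------------------------------------------------------------
-- Rational arithmetic

module Rationals where
  open import Data.Rational.Base using (_+_; _*_; _-_; -_; _/_; 1/_; _≤_; _<_; toℚᵘ) renaming (∣_∣ to abs)
  open +-*-Solver

  -- Opaque to keep the type checker from unfolding gcds.
  opaque
    frac : ℕ → ℕ → ℚ
    frac t n = + t / suc n

  ι : ℕ → ℚ
  ι n = frac n 0

  opaque
    unfolding frac

    frac-normalised : ∀ n d .(c : Coprimality.Coprime n (suc d)) → frac n d ≡ mkℚ (+ n) d c
    frac-normalised n d c = ℚ.normalize-coprime c

    frac-nonNeg : ∀ t n → 0ℚ ≤ frac t n
    frac-nonNeg t n = ℚ.nonNegative⁻¹ (+ t / suc n) {{ℚ.normalize-nonNeg t (suc n)}}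

    frac-zero : ∀ n → frac 0 n ≡ 0ℚ
    frac-zero n = ℚ.0/n≡0 (suc n)

    ι1≡1 : ι 1 ≡ 1ℚ
    ι1≡1 = refl

    frac-*-ι : ∀ t n → frac t n * ι (suc n) ≡ ι t
    frac-*-ι t n = ℚ.toℚᵘ-injective $ begin
      toℚᵘ ((+ t / suc n) * (+ suc n / 1))        ≈⟨ ℚ.toℚᵘ-homo-* (+ t / suc n) (+ suc n / 1) ⟩
      toℚᵘ (+ t / suc n) ℚᵘ.* toℚᵘ (+ suc n / 1)  ≈⟨ ℚᵘ.*-cong (ℚ.toℚᵘ-fromℚᵘ (ℚᵘ.mkℚᵘ (+ t) n))
                                                               (ℚ.toℚᵘ-fromℚᵘ (ℚᵘ.mkℚᵘ (+ suc n) 0)) ⟩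
      ℚᵘ.mkℚᵘ (+ t) n ℚᵘ.* ℚᵘ.mkℚᵘ (+ suc n) 0    ≈⟨ ℚᵘ.*≡* (ℤ.*-assoc (+ t) (+ suc n) (+ 1)) ⟩
      ℚᵘ.mkℚᵘ (+ t) 0                             ≈⟨ ℚᵘ.≃-sym (ℚ.toℚᵘ-fromℚᵘ (ℚᵘ.mkℚᵘ (+ t) 0)) ⟩
      toℚᵘ (+ t / 1)                              ∎
      where open ℚᵘ.≃-Reasoning

    ι-suc : ∀ n → ι (suc n) ≡ ι n + 1ℚ
    ι-suc n rewrite frac-normalised n 0 (Coprimality.sym (Coprimality.1-coprimeTo n)) =
      ℚ./-cong {p₁ = + suc n} {q₁ = 1}
        (trans (cong +_ (ℕ.+-comm 1 n)) (cong (ℤ._+ + 1) (sym (ℤ.*-identityʳ (+ n))))) refl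

  ι≡mkℚ : ∀ n → ι n ≡ mkℚ (+ n) 0 (Coprimality.sym (Coprimality.1-coprimeTo n))
  ι≡mkℚ n = frac-normalised n 0 (Coprimality.sym (Coprimality.1-coprimeTo n))

  ι-mono-≤ : ∀ {m n} → m ℕ.≤ n → ι m ≤ ι n
  ι-mono-≤ {m} {n} m≤n rewrite ι≡mkℚ m | ι≡mkℚ n =
    *≤* (ℤ.*-monoʳ-≤-nonNeg (+ 1) (ℤ.+≤+ m≤n))

  0≤ι : ∀ n → 0ℚ ≤ ι n
  0≤ι n = frac-nonNeg n 0

  0<ι : ∀ n → 0ℚ < ι (suc n)
  0<ι n rewrite ι≡mkℚ (suc n) =
    *<* (ℤ.*-monoʳ-<-pos (+ 1) (+<+ (s≤s (z≤n {n}))))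

  1≤ι : ∀ n → 1ℚ ≤ ι (suc n)
  1≤ι n = subst (_≤ ι (suc n)) ι1≡1 (ι-mono-≤ (s≤s z≤n))

  mul-interchange : ∀ p q r s → (p * q) * (r * s) ≡ (p * r) * (q * s)
  mul-interchange = solve 4 (λ p q r s → (p :* q) :* (r :* s) := (p :* r) :* (q :* s)) refl

  square-+ : ∀ p q → p * p + q * q + (p * q + p * q) ≡ (p + q) * (p + q)
  square-+ = solve 2 (λ p q → p :* p :+ q :* q :+ (p :* q :+ p :* q) := (p :+ q) :* (p :+ q)) refl

  neg-swap : ∀ p q → p - q ≡ - (q - p)
  neg-swap = solve 2 (λ p q → p :- q := :- (q :- p)) refl

  recip-diff : ∀ p q r s → r * (s * q) - (r * p) * s ≡ r * s * (q - p)
  recip-diff = solve 4 (λ p q r s → r :* (s :* q) :- (r :* p) :* s := r :* s :* (q :- p)) refl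

  double : ∀ p → p + p ≡ (1ℚ + 1ℚ) * p
  double = solve 1 (λ p → p :+ p := (con 1ℚ :+ con 1ℚ) :* p) refl

  cancel-- : ∀ p q → p - q + q ≡ p
  cancel-- = solve 2 (λ p q → p :- q :+ q := p) refl

  +-diff : ∀ p q r s → (p + q) - (r + s) ≡ (p - r) + (q - s)
  +-diff = solve 4 (λ p q r s → (p :+ q) :- (r :+ s) := (p :- r) :+ (q :- s)) refl

  *-diff : ∀ p q r s → p * q - r * s ≡ p * (q - s) + (p - r) * s
  *-diff = solve 4 (λ p q r s → p :* q :- r :* s := p :* (q :- s) :+ (p :- r) :* s) refl

  neg-diff : ∀ p q → - p - - q ≡ q - p
  neg-diff = solve 2 (λ p q → :- p :- :- q := q :- p) refl

  minus-zero : ∀ p → p - 0ℚ ≡ p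
  minus-zero p = ℚ.+-identityʳ p

  abs≤ : ∀ {p b} → p ≤ b → - p ≤ b → abs p ≤ b
  abs≤ {p} {b} p≤b -p≤b with ℚ.∣p∣≡p∨∣p∣≡-p p
  ... | inj₁ eq = subst (_≤ b) (sym eq) p≤b
  ... | inj₂ eq = subst (_≤ b) (sym eq) -p≤b

  p≤abs : ∀ p → p ≤ abs p
  p≤abs p with ℚ.≤-total 0ℚ p
  ... | inj₁ 0≤p = ℚ.≤-reflexive (sym (ℚ.0≤p⇒∣p∣≡p 0≤p))
  ... | inj₂ p≤0 = ℚ.≤-trans p≤0 (ℚ.0≤∣p∣ p)

  diff≤⇒≤ : ∀ {p q b} → p - q ≤ b → p ≤ q + b
  diff≤⇒≤ {p} {q} {b} p-q≤b =
    subst₂ _≤_ (cancel-- p q) (ℚ.+-comm b q) (ℚ.+-monoˡ-≤ q p-q≤b)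

  ≤⇒diff≤ : ∀ {p q b} → p ≤ q + b → p - q ≤ b
  ≤⇒diff≤ {p} {q} {b} p≤q+b = subst (p - q ≤_)
    (trans (cong (_- q) (ℚ.+-comm q b)) (trans (ℚ.+-assoc b q (- q))
      (trans (cong (λ r → b + r) (ℚ.+-inverseʳ q)) (ℚ.+-identityʳ b))))
    (ℚ.+-monoˡ-≤ (- q) p≤q+b)

  abs-swap : ∀ p q → abs (p - q) ≡ abs (q - p)
  abs-swap p q = trans
    (cong abs (neg-swap p q)) (ℚ.∣-p∣≡∣p∣ (q - p))

  0<* : ∀ {p q} → 0ℚ < p → 0ℚ < q → 0ℚ < p * q
  0<* {p} {q} 0<p 0<q =
    ℚ.positive⁻¹ (p * q) {{ℚ.pos*pos⇒pos p {{ℚ.positive 0<p}} q {{ℚ.positive 0<q}}}}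

  0<+ : ∀ {p q} → 0ℚ < p → 0ℚ < q → 0ℚ < p + q
  0<+ 0<p 0<q = ℚ.+-mono-< 0<p 0<q

  *-mono-≤ : ∀ {p q r s} → 0ℚ ≤ r → 0ℚ ≤ q → p ≤ q → r ≤ s → p * r ≤ q * s
  *-mono-≤ {p} {q} {r} {s} 0≤r 0≤q p≤q r≤s = ℚ.≤-trans
    (ℚ.*-monoʳ-≤-nonNeg r {{ℚ.nonNegative 0≤r}} p≤q)
    (ℚ.*-monoˡ-≤-nonNeg q {{ℚ.nonNegative 0≤q}} r≤s)

  square-cancel-≤ : ∀ {p q} → 0ℚ ≤ q → p * p ≤ q * q → p ≤ q
  square-cancel-≤ {p} {q} 0≤q p²≤q² with p ℚ.≤? q
  ... | yes p≤q = p≤q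
  ... | no  p≰q = contradiction (ℚ.<-≤-trans q²<p² p²≤q²) (ℚ.<-irrefl refl)
    where
    q<p   = ℚ.≰⇒> p≰q
    q²<p² = ℚ.≤-<-trans (ℚ.*-monoˡ-≤-nonNeg q {{ℚ.nonNegative 0≤q}} (ℚ.<⇒≤ q<p))
                        (ℚ.*-monoˡ-<-pos p {{ℚ.positive (ℚ.≤-<-trans 0≤q q<p)}} q<p)

  1/pos : ∀ {p} → 0ℚ < p → ∃ λ q → 0ℚ < q × p * q ≡ 1ℚ
  1/pos {p} 0<p = 1/ p , ℚ.positive⁻¹ (1/ p) {{ℚ.1/pos⇒pos p}} , ℚ.*-inverseʳ p
    where instance
      _ = ℚ.positive 0<p
      _ = ℚ.pos⇒nonZero p

  ≤ι∣↥∣ : ∀ p → p ≤ ι ℤ.∣ ↥ p ∣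
  ≤ι∣↥∣ (mkℚ (+ n) d c) rewrite ι≡mkℚ n =
    *≤* (ℤ.*-monoˡ-≤-nonNeg (+ n) (ℤ.+≤+ (s≤s (z≤n {d}))))
  ≤ι∣↥∣ p@(mkℚ -[1+ n ] d c) = ℚ.≤-trans (ℚ.<⇒≤ (ℚ.negative⁻¹ p)) (0≤ι (suc n))

  1≤*ι↧ : ∀ {p} → 0ℚ < p → 1ℚ ≤ p * ι (↧ₙ p)
  1≤*ι↧ {mkℚ (+ suc n) d c} _ = ℚ.≤-trans (1≤ι n) $ ℚ.≤-reflexive $ begin
    ι (suc n)                            ≡⟨ sym (frac-*-ι (suc n) d) ⟩
    frac (suc n) d * ι (suc d)        ≡⟨ cong (_* ι (suc d)) (frac-normalised (suc n) d c) ⟩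
    mkℚ (+ suc n) d c * ι (suc d)        ∎
    where open ≡-Reasoning
  1≤*ι↧ {mkℚ (+ 0) d c} (*<* (+<+ ()))
  1≤*ι↧ {mkℚ -[1+ n ] d c} (*<* ())

  frac1≤ : ∀ {p n} → 0ℚ < p → ↧ₙ p ℕ.≤ n → frac 1 n ≤ p
  frac1≤ {p} {n} 0<p ↧p≤n = ℚ.*-cancelʳ-≤-pos (ι (suc n)) {{ℚ.positive (0<ι n)}} $ begin
    frac 1 n * ι (suc n)   ≡⟨ trans (frac-*-ι 1 n) ι1≡1 ⟩
    1ℚ                          ≤⟨ 1≤*ι↧ 0<p ⟩
    p * ι (↧ₙ p)                ≤⟨ ℚ.*-monoˡ-≤-nonNeg p {{ℚ.nonNegative (ℚ.<⇒≤ 0<p)}}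
                                     (ι-mono-≤ (ℕ.m≤n⇒m≤1+n ↧p≤n)) ⟩
    p * ι (suc n)               ∎
    where open ℚ.≤-Reasoning

  -- The largest t ≤ b with t² ≤ q, or 0 if there is none.
  floorSqrtUpTo : ℕ → ℚ → ℕ
  floorSqrtUpTo zero    q = zero
  floorSqrtUpTo (suc b) q with ι (suc b) * ι (suc b) ℚ.≤? q
  ... | yes _ = suc b
  ... | no  _ = floorSqrtUpTo b q

  -- ⌊√q⌋ for 0 ≤ q, since then √q < ∣ ↥ q ∣ + 1; and 0 for q < 0.
  floorSqrt : ℚ → ℕ
  floorSqrt q = floorSqrtUpTo ℤ.∣ ↥ q ∣ q

  -- √q rounded down to a multiple of 1 / (1 + n); 0 for q < 0.
  approxSqrt : ℕ → ℚ → ℚ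
  approxSqrt n q = frac (floorSqrt (q * (ι (suc n) * ι (suc n)))) n

  floorSqrtUpTo-lower : ∀ b q → floorSqrtUpTo b q ≡ 0 ⊎
    ι (floorSqrtUpTo b q) * ι (floorSqrtUpTo b q) ≤ q
  floorSqrtUpTo-lower zero    q = inj₁ refl
  floorSqrtUpTo-lower (suc b) q with ι (suc b) * ι (suc b) ℚ.≤? q
  ... | yes b²≤q = inj₂ b²≤q
  ... | no  _    = floorSqrtUpTo-lower b q

  floorSqrtUpTo-upper : ∀ b q → q < ι (suc b) * ι (suc b) →
    q < ι (suc (floorSqrtUpTo b q)) * ι (suc (floorSqrtUpTo b q))
  floorSqrtUpTo-upper zero    q q<1 = q<1
  floorSqrtUpTo-upper (suc b) q q<b² with ι (suc b) * ι (suc b) ℚ.≤? q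
  ... | yes _    = q<b²
  ... | no  b²≰q = floorSqrtUpTo-upper b q (ℚ.≰⇒> b²≰q)

  floorSqrt-upper : ∀ q → q < ι (suc (floorSqrt q)) * ι (suc (floorSqrt q))
  floorSqrt-upper q = floorSqrtUpTo-upper b q $ begin-strict
    q                      ≤⟨ ≤ι∣↥∣ q ⟩
    ι b                    <⟨ subst (_< ι b + 1ℚ) (ℚ.+-identityʳ (ι b)) (ℚ.+-monoʳ-< (ι b) (ℚ.positive⁻¹ 1ℚ)) ⟩
    ι b + 1ℚ               ≡⟨ sym (ι-suc b) ⟩
    ι (suc b)              ≡⟨ sym (ℚ.*-identityʳ (ι (suc b))) ⟩
    ι (suc b) * 1ℚ         ≤⟨ ℚ.*-monoˡ-≤-nonNeg (ι (suc b)) {{ℚ.nonNegative (0≤ι (suc b))}}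
                                (1≤ι b) ⟩
    ι (suc b) * ι (suc b)  ∎
    where
    open ℚ.≤-Reasoning
    b = ℤ.∣ ↥ q ∣

  approxSqrt-nonNeg : ∀ n q → 0ℚ ≤ approxSqrt n q
  approxSqrt-nonNeg n q = frac-nonNeg _ n

  approxSqrt-lower : ∀ n q → approxSqrt n q ≡ 0ℚ ⊎ approxSqrt n q * approxSqrt n q ≤ q
  approxSqrt-lower n q with floorSqrtUpTo-lower ℤ.∣ ↥ (q * (ι (suc n) * ι (suc n))) ∣ (q * (ι (suc n) * ι (suc n)))
  ... | inj₁ t≡0  = inj₁ (trans (cong (λ t → frac t n) t≡0) (frac-zero n))
  ... | inj₂ t²≤q = inj₂ $ ℚ.*-cancelʳ-≤-pos (m * m) {{ℚ.positive (0<* (0<ι n) (0<ι n))}} $ begin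
    (s * s) * (m * m)  ≡⟨ mul-interchange s s m m ⟩
    (s * m) * (s * m)  ≡⟨ cong₂ _*_ (frac-*-ι t n) (frac-*-ι t n) ⟩
    ι t * ι t          ≤⟨ t²≤q ⟩
    q * (m * m)        ∎
    where
    open ℚ.≤-Reasoning
    s = approxSqrt n q
    m = ι (suc n)
    t = floorSqrt (q * (m * m))

  approxSqrt-upper : ∀ n q →
    q < (approxSqrt n q + frac 1 n) * (approxSqrt n q + frac 1 n)
  approxSqrt-upper n q =
    ℚ.*-cancelʳ-<-nonNeg (m * m) {{ℚ.nonNegative (ℚ.<⇒≤ (0<* (0<ι n) (0<ι n)))}} $ begin-strict
    q * (m * m)                    <⟨ floorSqrt-upper (q * (m * m)) ⟩
    ι (suc t) * ι (suc t)          ≡⟨ cong₂ _*_ eq eq ⟩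
    ((s + w) * m) * ((s + w) * m)  ≡⟨ mul-interchange (s + w) m (s + w) m ⟩
    ((s + w) * (s + w)) * (m * m)  ∎
    where
    open ℚ.≤-Reasoning
    s = approxSqrt n q
    w = frac 1 n
    m = ι (suc n)
    t = floorSqrt (q * (m * m))
    eq : ι (suc t) ≡ (s + w) * m
    eq = trans (ι-suc t) (sym (trans (ℚ.*-distribʳ-+ m s w) (cong₂ _+_ (frac-*-ι t n) (trans (frac-*-ι 1 n) ι1≡1))))

  approxSqrt-close : ∀ {ε} m n p q → 0ℚ < ε → p ≤ q + ε * ε →
    approxSqrt m p ≤ approxSqrt n q + frac 1 n + ε
  approxSqrt-close {ε} m n p q 0<ε p≤q+ε² with approxSqrt-lower m p
  ... | inj₁ s≡0  = subst (_≤ _) (sym s≡0) (ℚ.+-mono-≤ 0≤u (ℚ.<⇒≤ 0<ε))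
    where 0≤u = ℚ.+-mono-≤ (approxSqrt-nonNeg n q) (frac-nonNeg 1 n)
  ... | inj₂ s²≤p = square-cancel-≤ (ℚ.+-mono-≤ 0≤u 0≤ε) $ begin
    s * s                                ≤⟨ s²≤p ⟩
    p                                    ≤⟨ p≤q+ε² ⟩
    q + ε * ε                            ≤⟨ ℚ.+-monoˡ-≤ (ε * ε) (ℚ.<⇒≤ (approxSqrt-upper n q)) ⟩
    u * u + ε * ε                        ≡⟨ sym (ℚ.+-identityʳ _) ⟩
    u * u + ε * ε + 0ℚ                   ≤⟨ ℚ.+-monoʳ-≤ (u * u + ε * ε) (ℚ.+-mono-≤ 0≤uε 0≤uε) ⟩
    u * u + ε * ε + (u * ε + u * ε)      ≡⟨ square-+ u ε ⟩
    (u + ε) * (u + ε)                    ∎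
    where
    open ℚ.≤-Reasoning
    s   = approxSqrt m p
    u   = approxSqrt n q + frac 1 n
    0≤ε = ℚ.<⇒≤ 0<ε
    0≤u = ℚ.+-mono-≤ (approxSqrt-nonNeg n q) (frac-nonNeg 1 n)
    0≤uε = *-mono-≤ {0ℚ} {u} {0ℚ} {ε} ℚ.≤-refl 0≤u 0≤u 0≤ε

  product-close : ∀ {A B ε} p q r s → 0ℚ < A → 0ℚ < ε → abs p ≤ A → abs s ≤ B →
    abs (p - r) ≤ ε → abs (q - s) ≤ ε → abs (p * q - r * s) ≤ (A + B) * ε
  product-close {A} {B} {ε} p q r s 0<A 0<ε p≤A s≤B p-r≤ε q-s≤ε = begin
    abs (p * q - r * s)                        ≡⟨ cong abs (*-diff p q r s) ⟩
    abs (p * (q - s) + (p - r) * s)            ≤⟨ ℚ.∣p+q∣≤∣p∣+∣q∣ (p * (q - s)) ((p - r) * s) ⟩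
    abs (p * (q - s)) + abs ((p - r) * s)      ≡⟨ cong₂ _+_ (ℚ.∣p*q∣≡∣p∣*∣q∣ p (q - s)) (ℚ.∣p*q∣≡∣p∣*∣q∣ (p - r) s) ⟩
    abs p * abs (q - s) + abs (p - r) * abs s  ≤⟨ ℚ.+-mono-≤ left right ⟩
    A * ε + ε * B                              ≡⟨ cong (λ t → A * ε + t) (ℚ.*-comm ε B) ⟩
    A * ε + B * ε                              ≡⟨ sym (ℚ.*-distribʳ-+ ε A B) ⟩
    (A + B) * ε                                ∎
    where
    open ℚ.≤-Reasoning
    left : abs p * abs (q - s) ≤ A * ε
    left = *-mono-≤ (ℚ.0≤∣p∣ (q - s)) (ℚ.<⇒≤ 0<A) p≤A q-s≤ε
    right : abs (p - r) * abs s ≤ ε * B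
    right = *-mono-≤ (ℚ.0≤∣p∣ s) (ℚ.<⇒≤ 0<ε) p-r≤ε s≤B

  -- 1 / q, or 0 for q = 0.
  recip : ℚ → ℚ
  recip q with q ℚ.≟ 0ℚ
  ... | yes _   = 0ℚ
  ... | no  q≢0 = (1/ q) {{ℚ.≢-nonZero q≢0}}

  recip-inverse : ∀ {e} q → 0ℚ < e → e ≤ abs q → recip q * q ≡ 1ℚ
  recip-inverse q 0<e e≤∣q∣ with q ℚ.≟ 0ℚ
  ... | yes refl = contradiction (ℚ.<-≤-trans 0<e e≤∣q∣) (ℚ.<-irrefl refl)
  ... | no  q≢0  = ℚ.*-inverseˡ q {{ℚ.≢-nonZero q≢0}}

  abs-recip : ∀ {e f} q → 0ℚ < e → e * f ≡ 1ℚ → e ≤ abs q → abs (recip q) ≤ f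
  abs-recip {e} {f} q 0<e ef≡1 e≤∣q∣ = ℚ.*-cancelʳ-≤-pos e {{ℚ.positive 0<e}} $ begin
    abs r * e      ≤⟨ ℚ.*-monoˡ-≤-nonNeg (abs r) {{ℚ.∣-∣-nonNeg r}} e≤∣q∣ ⟩
    abs r * abs q  ≡⟨ sym (ℚ.∣p*q∣≡∣p∣*∣q∣ r q) ⟩
    abs (r * q)    ≡⟨ cong abs (recip-inverse q 0<e e≤∣q∣) ⟩
    1ℚ             ≡⟨ sym ef≡1 ⟩
    e * f          ≡⟨ ℚ.*-comm e f ⟩
    f * e          ∎
    where
    open ℚ.≤-Reasoning
    r = recip q

  recip-close : ∀ {e f} p q → 0ℚ < e → 0ℚ < f → e * f ≡ 1ℚ → e ≤ abs p → e ≤ abs q →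
    abs (recip p - recip q) ≤ f * f * abs (p - q)
  recip-close {e} {f} p q 0<e 0<f ef≡1 e≤∣p∣ e≤∣q∣ = begin
    abs (r - s)                  ≡⟨ cong abs (cong₂ (λ a b → a - b) (sym (ℚ.*-identityʳ r)) (sym (ℚ.*-identityˡ s))) ⟩
    abs (r * 1ℚ - 1ℚ * s)        ≡⟨ cong abs (cong₂ (λ a b → r * a - b * s)
                                      (sym (recip-inverse q 0<e e≤∣q∣)) (sym (recip-inverse p 0<e e≤∣p∣))) ⟩
    abs (r * (s * q) - (r * p) * s) ≡⟨ cong abs (recip-diff p q r s) ⟩
    abs (r * s * (q - p))        ≡⟨ ℚ.∣p*q∣≡∣p∣*∣q∣ (r * s) (q - p) ⟩
    abs (r * s) * abs (q - p)    ≡⟨ cong₂ _*_ (ℚ.∣p*q∣≡∣p∣*∣q∣ r s) (abs-swap q p) ⟩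
    abs r * abs s * abs (p - q)  ≤⟨ ℚ.*-monoʳ-≤-nonNeg (abs (p - q)) {{ℚ.∣-∣-nonNeg (p - q)}}
                                     (*-mono-≤ (ℚ.0≤∣p∣ s) (ℚ.<⇒≤ 0<f)
                                       (abs-recip p 0<e ef≡1 e≤∣p∣) (abs-recip q 0<e ef≡1 e≤∣q∣)) ⟩
    f * f * abs (p - q)          ∎
    where
    open ℚ.≤-Reasoning
    r = recip p
    s = recip q

------------------------------------------------------------------------
-- Real numbers: Cauchy sequences of rationals, up to _≃_

open Rationals

Eventually : (ℕ → Set) → Set
Eventually P = ∃ λ N → ∀ n → N ℕ.≤ n → P n

Cauchy : (ℕ → ℚ) → Set
Cauchy x = ∀ ε → 0ℚ ℚ.< ε →
  ∃ λ N → ∀ m n → N ℕ.≤ m → N ℕ.≤ n → ℚ.∣ x m ℚ.- x n ∣ ℚ.≤ ε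

record ℝ : Set where
  constructor mkℝ
  field
    seq    : ℕ → ℚ
    cauchy : Cauchy seq

open ℝ public

infix 4 _≃_ _≤_ _#_

_≃_ : ℝ → ℝ → Set
x ≃ y = ∀ ε → 0ℚ ℚ.< ε → Eventually λ n → ℚ.∣ seq x n ℚ.- seq y n ∣ ℚ.≤ ε

_≤_ : ℝ → ℝ → Set
x ≤ y = ∀ ε → 0ℚ ℚ.< ε → Eventually λ n → seq x n ℚ.≤ seq y n ℚ.+ ε

-- Apartness, the positive form of x ≠ y.
_#_ : ℝ → ℝ → Set
x # y = ∃ λ ε → 0ℚ ℚ.< ε × Eventually λ n → ε ℚ.≤ ℚ.∣ seq x n ℚ.- seq y n ∣

module _ where
  open import Data.Rational.Base using (_+_; _*_; _-_; -_) renaming (_≤_ to _≤ℚ_; _<_ to _<ℚ_; ∣_∣ to abs)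

  Bounded : (ℕ → ℚ) → Set
  Bounded x = ∃ λ B → 0ℚ <ℚ B × Eventually λ n → abs (x n) ≤ℚ B

  -- Opaque so that normalising a real number does not unfold its modulus.
  opaque
    cauchy-up-to : ∀ x C → 0ℚ <ℚ C →
      (∀ ε → 0ℚ <ℚ ε → ∃ λ N → ∀ m n → N ℕ.≤ m → N ℕ.≤ n → abs (x m - x n) ≤ℚ C * ε) →
      Cauchy x
    cauchy-up-to x C 0<C h ε 0<ε with 1/pos 0<C
    ... | D , 0<D , CD≡1 with h (D * ε) (0<* 0<D 0<ε)
    ... | N , close = N , λ m n N≤m N≤n → subst (_ ≤ℚ_)
      (trans (sym (ℚ.*-assoc C D ε)) (trans (cong (_* ε) CD≡1) (ℚ.*-identityˡ ε)))
      (close m n N≤m N≤n)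

    0<2 : 0ℚ <ℚ 1ℚ + 1ℚ
    0<2 = ℚ.positive⁻¹ (1ℚ + 1ℚ)

    const-cauchy : ∀ q → Cauchy (λ _ → q)
    const-cauchy q ε 0<ε = 0 , λ _ _ _ _ →
      subst (λ p → abs p ≤ℚ ε) (sym (ℚ.+-inverseʳ q)) (ℚ.<⇒≤ 0<ε)

    +-cauchy : ∀ x y → Cauchy x → Cauchy y → Cauchy (λ n → x n + y n)
    +-cauchy x y cx cy = cauchy-up-to (λ n → x n + y n) (1ℚ + 1ℚ) 0<2 λ ε 0<ε →
      let M , closex = cx ε 0<ε
          N , closey = cy ε 0<ε
      in M ℕ.⊔ N , λ m n h k → begin
        abs ((x m + y m) - (x n + y n))      ≡⟨ cong abs (+-diff (x m) (y m) (x n) (y n)) ⟩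
        abs ((x m - x n) + (y m - y n))      ≤⟨ ℚ.∣p+q∣≤∣p∣+∣q∣ (x m - x n) (y m - y n) ⟩
        abs (x m - x n) + abs (y m - y n)    ≤⟨ ℚ.+-mono-≤
                                                  (closex m n (ℕ.m⊔n≤o⇒m≤o M N h) (ℕ.m⊔n≤o⇒m≤o M N k))
                                                  (closey m n (ℕ.m⊔n≤o⇒n≤o M N h) (ℕ.m⊔n≤o⇒n≤o M N k)) ⟩
        ε + ε                                ≡⟨ double ε ⟩
        (1ℚ + 1ℚ) * ε                        ∎
      where open ℚ.≤-Reasoning

    neg-cauchy : ∀ x → Cauchy x → Cauchy (λ n → - x n)
    neg-cauchy x cx ε 0<ε with cx ε 0<ε
    ... | N , close = N , λ m n N≤m N≤n →
      subst (λ p → abs p ≤ℚ ε) (sym (neg-diff (x m) (x n))) (close n m N≤n N≤m)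

    cauchy-bounded : ∀ x → Cauchy x → Bounded x
    cauchy-bounded x cx with cx 1ℚ (ℚ.positive⁻¹ 1ℚ)
    ... | N , close =
      1ℚ + abs (x N) , ℚ.+-mono-<-≤ (ℚ.positive⁻¹ 1ℚ) (ℚ.0≤∣p∣ (x N)) , N , λ n N≤n → begin
        abs (x n)                        ≡⟨ cong abs (sym (cancel-- (x n) (x N))) ⟩
        abs (x n - x N + x N)            ≤⟨ ℚ.∣p+q∣≤∣p∣+∣q∣ (x n - x N) (x N) ⟩
        abs (x n - x N) + abs (x N)      ≤⟨ ℚ.+-monoˡ-≤ (abs (x N)) (close n N N≤n ℕ.≤-refl) ⟩
        1ℚ + abs (x N)                   ∎
      where open ℚ.≤-Reasoning

    *-cauchy : ∀ x y → Cauchy x → Cauchy y → Cauchy (λ n → x n * y n)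
    *-cauchy x y cx cy = go (cauchy-bounded x cx) (cauchy-bounded y cy)
      where
      go : Bounded x → Bounded y → Cauchy (λ n → x n * y n)
      go (A , 0<A , K , x≤A) (B , 0<B , L , y≤B) =
        cauchy-up-to (λ n → x n * y n) (A + B) (0<+ 0<A 0<B) λ ε 0<ε →
          let M , closex = cx ε 0<ε
              N , closey = cy ε 0<ε
          in (K ℕ.⊔ L) ℕ.⊔ (M ℕ.⊔ N) , λ m n h k →
            let KL≤m = ℕ.m⊔n≤o⇒m≤o (K ℕ.⊔ L) (M ℕ.⊔ N) h
                MN≤m = ℕ.m⊔n≤o⇒n≤o (K ℕ.⊔ L) (M ℕ.⊔ N) h
                KL≤n = ℕ.m⊔n≤o⇒m≤o (K ℕ.⊔ L) (M ℕ.⊔ N) k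
                MN≤n = ℕ.m⊔n≤o⇒n≤o (K ℕ.⊔ L) (M ℕ.⊔ N) k
            in product-close (x m) (y m) (x n) (y n) 0<A 0<ε
                 (x≤A m (ℕ.m⊔n≤o⇒m≤o K L KL≤m))
                 (y≤B n (ℕ.m⊔n≤o⇒n≤o K L KL≤n))
                 (closex m n (ℕ.m⊔n≤o⇒m≤o M N MN≤m) (ℕ.m⊔n≤o⇒m≤o M N MN≤n))
                 (closey m n (ℕ.m⊔n≤o⇒n≤o M N MN≤m) (ℕ.m⊔n≤o⇒n≤o M N MN≤n))

    sqrt-cauchy : ∀ x → Cauchy x → Cauchy (λ n → approxSqrt n (x n))
    sqrt-cauchy x cx = cauchy-up-to (λ n → approxSqrt n (x n)) (1ℚ + 1ℚ) 0<2 λ ε 0<ε →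
      let N , close = cx (ε * ε) (0<* 0<ε 0<ε)

          bound : ∀ m n → N ℕ.⊔ ↧ₙ ε ℕ.≤ m → N ℕ.⊔ ↧ₙ ε ℕ.≤ n →
            approxSqrt m (x m) - approxSqrt n (x n) ≤ℚ (1ℚ + 1ℚ) * ε
          bound m n h k = subst (_ ≤ℚ_) (double ε) $ ≤⇒diff≤ $ begin
            approxSqrt m (x m)                   ≤⟨ approxSqrt-close m n (x m) (x n) 0<ε
                                                      (diff≤⇒≤ (ℚ.≤-trans (p≤abs (x m - x n))
                                                        (close m n (ℕ.m⊔n≤o⇒m≤o N (↧ₙ ε) h) (ℕ.m⊔n≤o⇒m≤o N (↧ₙ ε) k)))) ⟩
            approxSqrt n (x n) + frac 1 n + ε    ≤⟨ ℚ.+-monoˡ-≤ ε (ℚ.+-monoʳ-≤ (approxSqrt n (x n))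
                                                      (frac1≤ 0<ε (ℕ.m⊔n≤o⇒n≤o N (↧ₙ ε) k))) ⟩
            approxSqrt n (x n) + ε + ε           ≡⟨ ℚ.+-assoc (approxSqrt n (x n)) ε ε ⟩
            approxSqrt n (x n) + (ε + ε)         ∎
      in N ℕ.⊔ ↧ₙ ε , λ m n h k → abs≤ (bound m n h k)
        (subst (_≤ℚ _) (neg-swap (approxSqrt n (x n)) (approxSqrt m (x m))) (bound n m k h))
      where open ℚ.≤-Reasoning

    recip-cauchy : ∀ x → Cauchy x →
      (∃ λ ε → 0ℚ <ℚ ε × Eventually λ n → ε ≤ℚ abs (x n - 0ℚ)) →
      Cauchy (λ n → recip (x n))
    recip-cauchy x cx (e , 0<e , M , e≤x) with 1/pos 0<e
    ... | f , 0<f , ef≡1 = cauchy-up-to (λ n → recip (x n)) (f * f) (0<* 0<f 0<f) λ ε 0<ε →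
      let N , close = cx ε 0<ε
          e≤∣x∣ = λ n M≤n → subst (λ p → e ≤ℚ abs p) (minus-zero (x n)) (e≤x n M≤n)
      in M ℕ.⊔ N , λ m n h k → ℚ.≤-trans
        (recip-close (x m) (x n) 0<e 0<f ef≡1
          (e≤∣x∣ m (ℕ.m⊔n≤o⇒m≤o M N h)) (e≤∣x∣ n (ℕ.m⊔n≤o⇒m≤o M N k)))
        (ℚ.*-monoˡ-≤-nonNeg (f * f) {{ℚ.nonNegative (ℚ.<⇒≤ (0<* 0<f 0<f))}}
          (close m n (ℕ.m⊔n≤o⇒n≤o M N h) (ℕ.m⊔n≤o⇒n≤o M N k)))

infixl 7 _*_ _/_
infixl 6 _+_
infix  8 -_ √_

fromℚ : ℚ → ℝ
fromℚ q = mkℝ (λ _ → q) (const-cauchy q)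

fromℕ→ℝ : ℕ → ℝ
fromℕ→ℝ n = fromℚ (+ n ℚ./ 1)

0ℝ 1ℝ : ℝ
0ℝ = fromℚ 0ℚ
1ℝ = fromℚ 1ℚ

_+_ : ℝ → ℝ → ℝ
x + y = mkℝ (λ n → seq x n ℚ.+ seq y n) (+-cauchy (seq x) (seq y) (cauchy x) (cauchy y))

_*_ : ℝ → ℝ → ℝ
x * y = mkℝ (λ n → seq x n ℚ.* seq y n) (*-cauchy (seq x) (seq y) (cauchy x) (cauchy y))

-_ : ℝ → ℝ
- x = mkℝ (λ n → ℚ.- seq x n) (neg-cauchy (seq x) (cauchy x))

_/_ : (x y : ℝ) → {{y # 0ℝ}} → ℝ
_/_ x y {{y#0}} = x * mkℝ (λ n → recip (seq y n)) (recip-cauchy (seq y) (cauchy y) y#0)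

-- The nonnegative square root; √x = 0 for x ≤ 0.
√_ : ℝ → ℝ
√ x = mkℝ (λ n → approxSqrt n (seq x n)) (sqrt-cauchy (seq x) (cauchy x))

ℝ-rawRing : RawRing 0ℓ 0ℓ
ℝ-rawRing = record
  { Carrier = ℝ
  ; _≈_     = _≃_
  ; _+_     = _+_
  ; _*_     = _*_
  ; -_      = -_
  ; 0#      = 0ℝ
  ; 1#      = 1ℝ
  }

------------------------------------------------------------------------
-- Volumes of finite sets of points

open Determinant ℝ-rawRing public
open import Algebra.Definitions.RawSemiring (RawRing.rawSemiring ℝ-rawRing) using (sum)

Point : ℕ → Set
Point d = Vector ℝ d

infix 4 _≈_

_≈_ : ∀ {d} → Point d → Point d → Set
u ≈ v = ∀ i → u i ≃ v i

⟨_,_⟩ : ∀ {d} → Point d → Point d → ℝ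
⟨ u , v ⟩ = sum λ i → u i * v i

gram : ∀ {d r} → Vector (Point d) r → Matrix r
gram u a b = ⟨ u a , u b ⟩

-- The elements of S, in increasing order.
elements : ∀ {n} (S : Subset n) → Vector (Fin n) ∣ S ∣
elements (inside  ∷ S) zero    = zero
elements (inside  ∷ S) (suc i) = suc (elements S i)
elements (outside ∷ S) i       = suc (elements S i)

-- Subsets of a finite point set {P i} are given by subsets of its index set.
vol : ∀ {d n} → Vector (Point d) n → Subset n → ℝ
vol P S = √ det (gram (P ∘ elements S))

------------------------------------------------------------------------
-- The greedy algorithm

-- Greedy P i C: after i steps on the point set P, with some way of breaking
-- ties, the algorithm can have selected exactly the points indexed by C.
data Greedy {d n} (P : Vector (Point d) n) : ℕ → Subset n → Set where
  start : Greedy P 0 ⊥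
  step  : ∀ {i} {C : Subset n} {p : Fin n} → Greedy P i C → p ∉ C →
          (∀ q → q ∉ C → vol P (C ∪ ⁅ q ⁆) ≤ vol P (C ∪ ⁅ p ⁆)) →
          Greedy P (suc i) (C ∪ ⁅ p ⁆)

{-# OPTIONS --safe #-}
module Submission where

open import Algebra.Bundles using (CommutativeRing; RawRing)
open import Algebra.Structures using (IsCommutativeRing)
open import Data.Fin.Base using (Fin; zero; suc; fromℕ; toℕ; inject₁; punchIn)
open import Data.Fin.Induction using (<-weakInduction)
open import Data.Fin.Properties using (_≟_; suc-injective; toℕ-inject₁; toℕ-fromℕ)
open import Data.Fin.Subset using (Subset; inside; outside; ⊥; ⊤; _-_; _∪_; ⁅_⁆; _∉_) renaming (∣_∣ to card)
open import Data.Fin.Subset.Properties using (∪-identityˡ; ∪-identityʳ; ∣⊥∣≡0)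
open import Data.Nat.Base as ℕ using (ℕ; zero; suc; NonZero)
import Data.Nat.Properties as ℕ
open import Data.Product.Base using (Σ; _×_; _,_)
open import Data.Rational.Base as ℚ using (ℚ; 0ℚ; 1ℚ; ↧ₙ_)
import Data.Rational.Properties as ℚ
open import Data.Rational.Solver using (module +-*-Solver)
open import Data.Sum.Base using (inj₁; inj₂)
open import Data.Vec.Base using (_∷_; here; there; tail)
open import Data.Vec.Functional using (Vector)
open import Defs using (module Determinant)
open import Function.Base using (_∘_; _$_)
open import Function.Definitions using (Injective)
open import Level using (0ℓ)
open import Relation.Binary.PropositionalEquality as ≡ using (_≡_; _≢_; subst; subst₂)
import Relation.Binary.Reasoning.Setoid as SetoidReasoning
open import Relation.Nullary.Decidable using (yes; no; from-yes)
open import Relation.Nullary.Negation.Core using (¬_; contradiction)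

-- Take v₁ = t (1, …, 1) with t = -1/√k, and the standard basis e₁, …, e_k of ℝᵏ
-- as v₂, …, v₍k₊₁₎. All points are unit vectors, so v₁ may be picked first; then
-- the remaining points are interchangeable, so every later step is a tie. The
-- Gram matrix of v₁ and n basis vectors is an arrow matrix with determinant
-- 1 - n t², which is 1/k for V, whereas V - v₁ + v₍k₊₁₎ is orthonormal.
-- The sign of t keeps the two points distinct when k = 1.

-- Arrow determinants and Gram matrices over a commutative ring.

module ArrowDeterminant {c ℓ} (R : CommutativeRing c ℓ) where
  open CommutativeRing R hiding (zero; _-_)
  open RawRing rawRing using (rawSemiring)
  open Determinant rawRing renaming (det to ∣_∣; Matrix to Mat)
  open import Algebra.Properties.Ring ring
  open import Algebra.Properties.Semiring.Sum semiring
  open import Algebra.Properties.CommutativeMonoid.Mult +-commutativeMonoid using (×-congʳ; ×-distrib-+)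
  open import Algebra.Definitions.RawSemiring rawSemiring using (_^_) renaming (_×_ to _·_)
  open SetoidReasoning setoid

  minor : ∀ {n} → Mat (suc n) → Fin (suc n) → Mat n
  minor M j a b = M (suc a) (punchIn j b)

  det-cong : ∀ {n} {M N : Mat n} → (∀ a b → M a b ≈ N a b) → ∣ M ∣ ≈ ∣ N ∣
  det-cong {zero}  M≈N = refl
  det-cong {suc n}  M≈N = sum-cong-≋ λ j → *-congˡ {(- 1#) ^ toℕ j}
    (*-cong (M≈N zero j) (det-cong λ a b → M≈N (suc a) (punchIn j b)))

  sum-zero : ∀ {n} {x : Vector Carrier n} → (∀ i → x i ≈ 0#) → sum x ≈ 0#
  sum-zero {n} x≈0 = trans (sum-cong-≋ x≈0) (sum-replicate-zero n)

  sum-const : ∀ {n x} {y : Vector Carrier n} → (∀ i → y i ≈ x) → sum y ≈ n · x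
  sum-const {n} y≈x = trans (sum-cong-≋ y≈x) (sum-replicate n)

  term-zero : ∀ s {x} d → x ≈ 0# → s * (x * d) ≈ 0#
  term-zero s d x≈0 = trans (*-congˡ (trans (*-congʳ x≈0) (zeroˡ d))) (zeroʳ s)

  -- Expansion is along the first row: the minor that deletes the zero column has a zero
  -- coefficient, and every other minor inherits the zero column, so induction applies.
  det-zero-column : ∀ n (M : Mat (suc n)) → (∀ a → M a zero ≈ 0#) → ∣ M ∣ ≈ 0#
  det-zero-column n M col≈0 = sum-zero {suc n} (term n M col≈0)
    where
    term : ∀ n (M : Mat (suc n)) → (∀ a → M a zero ≈ 0#) →
      ∀ j → (- 1#) ^ toℕ j * (M zero j * ∣ minor M j ∣) ≈ 0#
    term n       M col≈0 zero    = term-zero 1# ∣ minor M zero ∣ (col≈0 zero)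
    term (suc n) M col≈0 (suc j) = trans
      (*-congˡ (trans (*-congˡ (det-zero-column n (minor M (suc j)) (col≈0 ∘ suc))) (zeroʳ _)))
      (zeroʳ ((- 1#) ^ toℕ (suc j)))

  -- The identity matrix, whose rows also serve as the standard basis. Recursion on both indices
  -- makes `minor δ zero` compute to `δ`.
  δ : ∀ {n} → Mat n
  δ zero    zero    = 1#
  δ zero    (suc b) = 0#
  δ (suc a) zero    = 0#
  δ (suc a) (suc b) = δ a b

  det-first-entry : ∀ n (M : Mat (suc n)) → (∀ b → M zero (suc b) ≈ 0#) →
    ∣ M ∣ ≈ M zero zero * ∣ minor M zero ∣
  det-first-entry n M row≈0 = begin
    1# * (M zero zero * ∣ minor M zero ∣) + sum (λ j → (- 1#) ^ toℕ (suc j) * (M zero (suc j) * ∣ minor M (suc j) ∣))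
      ≈⟨ +-cong (*-identityˡ _) (sum-zero {n} λ j → term-zero ((- 1#) ^ toℕ (suc j)) ∣ minor M (suc j) ∣ (row≈0 j)) ⟩
    M zero zero * ∣ minor M zero ∣ + 0#
      ≈⟨ +-identityʳ _ ⟩
    M zero zero * ∣ minor M zero ∣ ∎

  det-δ : ∀ n → ∣ δ {n} ∣ ≈ 1#
  det-δ zero    = refl
  det-δ (suc n) = trans (det-first-entry n δ λ _ → refl) (trans (*-identityˡ _) (det-δ n))

  -- The first-row minors of an arrow matrix, other than the identity.
  bordered : ∀ {n} → Carrier → Fin (suc n) → Mat (suc n)
  bordered x j a zero    = x
  bordered x j a (suc b) = δ a (punchIn j b)

  -- Moving the constant column `x` to position `j` takes `j` transpositions. In the induction, the
  -- top row for `suc j` is (x, 1, 0, ...): the minor at `x` has a zero first column, and the minor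
  -- at 1 is `bordered x j`, with one more sign.
  det-bordered : ∀ {n} x (j : Fin (suc n)) → ∣ bordered x j ∣ ≈ (- 1#) ^ toℕ j * x
  det-bordered {n} x zero = begin
    ∣ bordered x (zero {n}) ∣   ≈⟨ det-first-entry n (bordered x zero) (λ _ → refl) ⟩
    x * ∣ δ {n} ∣               ≈⟨ *-congˡ (det-δ n) ⟩
    x * 1#                      ≈⟨ *-comm x 1# ⟩
    1# * x                      ∎
  det-bordered {suc n} x (suc j) = begin
    1# * (x * ∣ minor M zero ∣) + ((- 1#) * 1# * (1# * ∣ minor M (suc zero) ∣) + rest)
      ≈⟨ +-cong (trans (*-identityˡ _) (trans (*-congˡ (det-zero-column n (minor M zero) λ _ → refl)) (zeroʳ x)))
                (+-cong (*-cong (*-identityʳ _) (*-identityˡ _))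
                        (sum-zero {n} λ i → term-zero ((- 1#) ^ toℕ (suc (suc i))) ∣ minor M (suc (suc i)) ∣ refl)) ⟩
    0# + ((- 1#) * ∣ minor M (suc zero) ∣ + 0#)
      ≈⟨ trans (+-identityˡ _) (+-identityʳ _) ⟩
    (- 1#) * ∣ minor M (suc zero) ∣
      ≈⟨ *-congˡ (det-cong {M = minor M (suc zero)} {bordered x j} λ { a zero → refl ; a (suc b) → refl }) ⟩
    (- 1#) * ∣ bordered x j ∣
      ≈⟨ *-congˡ (det-bordered x j) ⟩
    (- 1#) * ((- 1#) ^ toℕ j * x)
      ≈⟨ *-assoc _ _ _ ⟨
    (- 1#) ^ toℕ (suc j) * x ∎
    where
    M = bordered x (suc j)
    rest = sum λ i → (- 1#) ^ toℕ (suc (suc i)) * (M zero (suc (suc i)) * ∣ minor M (suc (suc i)) ∣)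

  arrow : ∀ {n} → Carrier → Carrier → Mat (suc n)
  arrow a x zero    zero    = a
  arrow a x zero    (suc j) = x
  arrow a x (suc i) zero    = x
  arrow a x (suc i) (suc j) = δ i j

  -x*-x≈x*x : ∀ x → (- x) * (- x) ≈ x * x
  -x*-x≈x*x x = begin
    (- x) * (- x)  ≈⟨ -‿distribˡ-* x (- x) ⟨
    - (x * (- x))  ≈⟨ -‿cong (-‿distribʳ-* x x) ⟨
    - (- (x * x))  ≈⟨ -‿involutive _ ⟩
    x * x          ∎

  [-1]^n*[-1]^n≈1 : ∀ n → (- 1#) ^ n * (- 1#) ^ n ≈ 1#
  [-1]^n*[-1]^n≈1 zero  = *-identityˡ 1#
  [-1]^n*[-1]^n≈1 (suc n) = begin
    (- 1# * s) * (- 1# * s)  ≈⟨ *-cong (-1*x≈-x s) (-1*x≈-x s) ⟩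
    (- s) * (- s)            ≈⟨ -x*-x≈x*x s ⟩
    s * s                    ≈⟨ [-1]^n*[-1]^n≈1 n ⟩
    1#                       ∎
    where s = (- 1#) ^ n

  -- The corner contributes `a`. At column `suc j` the sign (-1)^(j+1) of the expansion meets the
  -- (-1)^j of `det-bordered`, so each of the other n terms is -x².
  det-arrow : ∀ n a x → ∣ arrow {n} a x ∣ ≈ a + n · (- (x * x))
  det-arrow n a x = +-cong
    (trans (*-identityˡ _) (trans (*-congˡ (det-δ n)) (*-identityʳ a)))
    (terms n)
    where
    term : ∀ n (j : Fin n) → (- 1#) ^ toℕ (suc j) * (x * ∣ minor (arrow a x) (suc j) ∣) ≈ - (x * x)
    term (suc n) j = begin
      - 1# * s * (x * ∣ minor (arrow a x) (suc j) ∣)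
        ≈⟨ *-cong (-1*x≈-x s) (*-congˡ (trans
             (det-cong {M = minor (arrow a x) (suc j)} {bordered x j} λ { a zero → refl ; a (suc b) → refl })
             (det-bordered x j))) ⟩
      - s * (x * (s * x))
        ≈⟨ -‿distribˡ-* s _ ⟨
      - (s * (x * (s * x)))
        ≈⟨ -‿cong (*-congˡ (trans (sym (*-assoc x s x)) (trans (*-congʳ (*-comm x s)) (*-assoc s x x)))) ⟩
      - (s * (s * (x * x)))
        ≈⟨ -‿cong (trans (sym (*-assoc s s _)) (trans (*-congʳ ([-1]^n*[-1]^n≈1 (toℕ j))) (*-identityˡ _))) ⟩
      - (x * x) ∎
      where s = (- 1#) ^ toℕ j

    terms : ∀ n → sum {n} (λ j → (- 1#) ^ toℕ (suc j) * (x * ∣ minor (arrow a x) (suc j) ∣)) ≈ n · (- (x * x))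
    terms n = sum-const (term n)

  δ-inner : ∀ {n} (i : Fin n) (x : Vector Carrier n) → sum (λ l → δ i l * x l) ≈ x i
  δ-inner zero    x = trans (+-cong (*-identityˡ _) (sum-zero λ l → zeroˡ (x (suc l)))) (+-identityʳ _)
  δ-inner (suc i) x = trans (+-cong (zeroˡ _) (δ-inner i (x ∘ suc))) (+-identityˡ _)

  δ-diagonal : ∀ {n} (a : Fin n) → δ a a ≡ 1#
  δ-diagonal zero    = ≡.refl
  δ-diagonal (suc a) = δ-diagonal a

  δ-off-diagonal : ∀ {n} {a b : Fin n} → a ≢ b → δ a b ≡ 0#
  δ-off-diagonal {a = zero}  {zero}  a≢b = contradiction ≡.refl a≢b
  δ-off-diagonal {a = zero}  {suc b} a≢b = ≡.refl
  δ-off-diagonal {a = suc a} {zero}  a≢b = ≡.refl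
  δ-off-diagonal {a = suc a} {suc b} a≢b = δ-off-diagonal (a≢b ∘ ≡.cong suc)

  -- Makes the Gram matrix of basis vectors listed without repetition by `e` independent of which
  -- ones are listed.
  δ-injective : ∀ {n k} {e : Fin n → Fin k} → Injective _≡_ _≡_ e → ∀ a b → δ (e a) (e b) ≡ δ a b
  δ-injective {e = e} e-inj a b with a ≟ b
  ... | yes ≡.refl = ≡.trans (δ-diagonal (e a)) (≡.sym (δ-diagonal a))
  ... | no  a≢b    = ≡.trans (δ-off-diagonal (a≢b ∘ e-inj)) (≡.sym (δ-off-diagonal a≢b))

  module _ {n k} (e : Fin n → Fin k) (e-inj : Injective _≡_ _≡_ e) where

    inner-basis : ∀ a b → sum (λ i → δ (e a) i * δ (e b) i) ≈ δ a b
    inner-basis a b = begin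
      sum (λ i → δ (e a) i * δ (e b) i)  ≈⟨ sum-cong-≋ (λ i → *-comm (δ (e a) i) (δ (e b) i)) ⟩
      sum (λ i → δ (e b) i * δ (e a) i)  ≈⟨ δ-inner (e b) (δ (e a)) ⟩
      δ (e a) (e b)                      ≡⟨ δ-injective e-inj a b ⟩
      δ a b                              ∎

    det-gram-basis : ∣ (λ a b → sum λ i → δ (e a) i * δ (e b) i) ∣ ≈ 1#
    det-gram-basis = trans (det-cong inner-basis) (det-δ n)

    -- Since k t² = 1 the first vector has length 1, and its inner product with each basis vector is
    -- `t`; hence the Gram matrix is `arrow 1# t`.
    det-gram-diagonal-vector : ∀ {t} (u : Vector (Vector Carrier k) (suc n)) →
      (∀ i → u zero i ≡ t) → (∀ a i → u (suc a) i ≡ δ (e a) i) → k · (t * t) ≈ 1# →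
      ∣ (λ a b → sum λ i → u a i * u b i) ∣ ≈ 1# + n · (- (t * t))
    det-gram-diagonal-vector {t} u u₀≡t u≡δ kt²≈1 = trans (det-cong entries) (det-arrow n 1# t)
      where
      entries : ∀ a b → sum (λ i → u a i * u b i) ≈ arrow 1# t a b
      entries zero zero = trans (sum-const λ i → reflexive (≡.cong₂ _*_ (u₀≡t i) (u₀≡t i))) kt²≈1
      entries zero (suc b) = trans
        (sum-cong-≋ λ i → trans (*-comm _ _) (reflexive (≡.cong₂ _*_ (u≡δ b i) (u₀≡t i))))
        (δ-inner (e b) λ _ → t)
      entries (suc a) zero = trans
        (sum-cong-≋ λ i → reflexive (≡.cong₂ _*_ (u≡δ a i) (u₀≡t i)))
        (δ-inner (e a) λ _ → t)
      entries (suc a) (suc b) = trans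
        (sum-cong-≋ λ i → reflexive (≡.cong₂ _*_ (u≡δ a i) (u≡δ b i)))
        (inner-basis a b)

  -- With x = t² and k = m + 1 this evaluates the determinant 1 - (k - 1)t² without any division.
  1+m·-x≈x : ∀ m x → suc m · x ≈ 1# → 1# + m · (- x) ≈ x
  1+m·-x≈x m x x+mx≈1 = begin
    1# + m · (- x)             ≈⟨ +-congʳ x+mx≈1 ⟨
    (x + m · x) + m · (- x)    ≈⟨ +-assoc _ _ _ ⟩
    x + (m · x + m · (- x))    ≈⟨ +-congˡ (×-distrib-+ x (- x) m) ⟨
    x + m · (x + - x)           ≈⟨ +-congˡ (×-congʳ m (-‿inverseʳ x)) ⟩
    x + m · 0#                 ≈⟨ +-congˡ (sum-replicate m) ⟨
    x + sum {m} (λ _ → 0#)     ≈⟨ +-congˡ (sum-replicate-zero m) ⟩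
    x + 0#                     ≈⟨ +-identityʳ x ⟩
    x                          ∎

-- The commutative ring of Cauchy reals.

open import Defs
open Rationals
open import Algebra.Definitions.RawSemiring (RawRing.rawSemiring ℝ-rawRing) using () renaming (_×_ to _·_)

0<1 : 0ℚ ℚ.< 1ℚ
0<1 = ℚ.positive⁻¹ 1ℚ

abs≡ : ∀ {p q ε} → p ≡ q → 0ℚ ℚ.≤ ε → ℚ.∣ p ℚ.- q ∣ ℚ.≤ ε
abs≡ {p} {ε = ε} ≡.refl 0≤ε = subst (λ r → ℚ.∣ r ∣ ℚ.≤ ε) (≡.sym (ℚ.+-inverseʳ p)) 0≤ε

pointwise : ∀ {x y} → (∀ n → seq x n ≡ seq y n) → x ≃ y
pointwise x≡y ε 0<ε = 0 , λ n _ → abs≡ (x≡y n) (ℚ.<⇒≤ 0<ε)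

eventually₂ : ∀ {P Q R : ℕ → Set} → (∀ n → P n → Q n → R n) → Eventually P → Eventually Q → Eventually R
eventually₂ f (M , p) (N , q) = M ℕ.⊔ N , λ n h →
  f n (p n (ℕ.m⊔n≤o⇒m≤o M N h)) (q n (ℕ.m⊔n≤o⇒n≤o M N h))

eventually : ∀ {P Q : ℕ → Set} → (∀ n → P n → Q n) → Eventually P → Eventually Q
eventually f (N , p) = N , λ n h → f n (p n h)

-- Replacing ε by ε / C absorbs the constant, so later estimates may end in any fixed positive
-- multiple of ε.
≃-up-to : ∀ {x y} C → 0ℚ ℚ.< C →
  (∀ ε → 0ℚ ℚ.< ε → Eventually λ n → ℚ.∣ seq x n ℚ.- seq y n ∣ ℚ.≤ C ℚ.* ε) → x ≃ y
≃-up-to {x} {y} C 0<C h ε 0<ε with 1/pos 0<C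
... | D , 0<D , CD≡1 = eventually (λ n → subst (ℚ.∣ seq x n ℚ.- seq y n ∣ ℚ.≤_) eq) (h (D ℚ.* ε) (0<* 0<D 0<ε))
  where
  eq : C ℚ.* (D ℚ.* ε) ≡ ε
  eq = ≡.trans (≡.sym (ℚ.*-assoc C D ε)) (≡.trans (≡.cong (ℚ._* ε) CD≡1) (ℚ.*-identityˡ ε))

≃-sym : ∀ {x y} → x ≃ y → y ≃ x
≃-sym {x} {y} x≃y ε 0<ε = eventually (λ n → subst (ℚ._≤ ε) (abs-swap (seq x n) (seq y n))) (x≃y ε 0<ε)

≃-trans : ∀ {x y z} → x ≃ y → y ≃ z → x ≃ z
≃-trans {x} {y} {z} x≃y y≃z = ≃-up-to {x} {z} (1ℚ ℚ.+ 1ℚ) 0<2 λ ε 0<ε →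
  eventually₂ (λ n p q → begin
    ℚ.∣ seq x n ℚ.- seq z n ∣
      ≡⟨ ≡.cong ℚ.∣_∣ (telescope (seq x n) (seq y n) (seq z n)) ⟩
    ℚ.∣ (seq x n ℚ.- seq y n) ℚ.+ (seq y n ℚ.- seq z n) ∣
      ≤⟨ ℚ.∣p+q∣≤∣p∣+∣q∣ (seq x n ℚ.- seq y n) (seq y n ℚ.- seq z n) ⟩
    ℚ.∣ seq x n ℚ.- seq y n ∣ ℚ.+ ℚ.∣ seq y n ℚ.- seq z n ∣
      ≤⟨ ℚ.+-mono-≤ p q ⟩
    ε ℚ.+ ε
      ≡⟨ double ε ⟩
    (1ℚ ℚ.+ 1ℚ) ℚ.* ε ∎) (x≃y ε 0<ε) (y≃z ε 0<ε)
  where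
  open ℚ.≤-Reasoning
  open +-*-Solver
  telescope : ∀ p q r → p ℚ.- r ≡ (p ℚ.- q) ℚ.+ (q ℚ.- r)
  telescope = solve 3 (λ p q r → p :- r := (p :- q) :+ (q :- r)) ≡.refl

≃⇒≤ : ∀ {x y} → x ≃ y → x ≤ y
≃⇒≤ {x} {y} x≃y ε 0<ε = eventually
  (λ n close → diff≤⇒≤ {seq x n} {seq y n} (ℚ.≤-trans (p≤abs (seq x n ℚ.- seq y n)) close)) (x≃y ε 0<ε)

+-cong-≃ : ∀ {x x′ y y′} → x ≃ x′ → y ≃ y′ → x + y ≃ x′ + y′
+-cong-≃ {x} {x′} {y} {y′} x≃x′ y≃y′ = ≃-up-to {x + y} {x′ + y′} (1ℚ ℚ.+ 1ℚ) 0<2 λ ε 0<ε →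
  eventually₂ (λ n p q → begin
    ℚ.∣ (seq x n ℚ.+ seq y n) ℚ.- (seq x′ n ℚ.+ seq y′ n) ∣
      ≡⟨ ≡.cong ℚ.∣_∣ (+-diff (seq x n) (seq y n) (seq x′ n) (seq y′ n)) ⟩
    ℚ.∣ (seq x n ℚ.- seq x′ n) ℚ.+ (seq y n ℚ.- seq y′ n) ∣
      ≤⟨ ℚ.∣p+q∣≤∣p∣+∣q∣ (seq x n ℚ.- seq x′ n) (seq y n ℚ.- seq y′ n) ⟩
    ℚ.∣ seq x n ℚ.- seq x′ n ∣ ℚ.+ ℚ.∣ seq y n ℚ.- seq y′ n ∣
      ≤⟨ ℚ.+-mono-≤ p q ⟩
    ε ℚ.+ ε
      ≡⟨ double ε ⟩
    (1ℚ ℚ.+ 1ℚ) ℚ.* ε ∎) (x≃x′ ε 0<ε) (y≃y′ ε 0<ε)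
  where open ℚ.≤-Reasoning

-- Cauchy sequences are bounded; `A` and `B` bound the factors `x` and `y′` that survive in xy -
-- x′y′ = x(y - y′) + (x - x′)y′.
*-cong-≃ : ∀ {x x′ y y′} → x ≃ x′ → y ≃ y′ → x * y ≃ x′ * y′
*-cong-≃ {x} {x′} {y} {y′} x≃x′ y≃y′
  with cauchy-bounded (seq x) (cauchy x) | cauchy-bounded (seq y′) (cauchy y′)
... | A , 0<A , x≤A | B , 0<B , y′≤B = ≃-up-to {x * y} {x′ * y′} (A ℚ.+ B) (0<+ 0<A 0<B) λ ε 0<ε →
  eventually₂
    (λ n (a , b) (c , d) → product-close (seq x n) (seq y n) (seq x′ n) (seq y′ n) 0<A 0<ε a b c d)
    (eventually₂ (λ _ → _,_) x≤A y′≤B)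
    (eventually₂ (λ _ → _,_) (x≃x′ ε 0<ε) (y≃y′ ε 0<ε))

neg-cong-≃ : ∀ {x y} → x ≃ y → - x ≃ - y
neg-cong-≃ {x} {y} x≃y ε 0<ε = eventually (λ n → subst (ℚ._≤ ε)
  (≡.trans (abs-swap (seq x n) (seq y n)) (≡.cong ℚ.∣_∣ (≡.sym (neg-diff (seq x n) (seq y n))))))
  (x≃y ε 0<ε)

-- Arguments within ε² have roots within ε. Rounding at stage n costs a further 1/(1+n), which is at
-- most ε once n reaches the denominator of ε; hence the factor 2.
√-cong : ∀ {x y} → x ≃ y → √ x ≃ √ y
√-cong {x} {y} x≃y = ≃-up-to {√ x} {√ y} (1ℚ ℚ.+ 1ℚ) 0<2 λ ε 0<ε →
  eventually₂ (λ n close h →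
    abs≤ (bound (seq x n) (seq y n) 0<ε n h close) (subst (ℚ._≤ _) (neg-swap (seq (√ y) n) (seq (√ x) n))
      (bound (seq y n) (seq x n) 0<ε n h (subst (ℚ._≤ ε ℚ.* ε) (abs-swap (seq x n) (seq y n)) close))))
    (x≃y (ε ℚ.* ε) (0<* 0<ε 0<ε)) (↧ₙ ε , λ _ h → h)
  where
  open ℚ.≤-Reasoning
  bound : ∀ p q {ε} → 0ℚ ℚ.< ε → ∀ n → ↧ₙ ε ℕ.≤ n → ℚ.∣ p ℚ.- q ∣ ℚ.≤ ε ℚ.* ε →
    approxSqrt n p ℚ.- approxSqrt n q ℚ.≤ (1ℚ ℚ.+ 1ℚ) ℚ.* ε
  bound p q {ε} 0<ε n h close = subst (_ ℚ.≤_) (double ε) $ ≤⇒diff≤ $ begin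
    approxSqrt n p                          ≤⟨ approxSqrt-close n n p q 0<ε (diff≤⇒≤ (ℚ.≤-trans (p≤abs (p ℚ.- q)) close)) ⟩
    approxSqrt n q ℚ.+ frac 1 n ℚ.+ ε       ≤⟨ ℚ.+-monoˡ-≤ ε (ℚ.+-monoʳ-≤ (approxSqrt n q) (frac1≤ 0<ε h)) ⟩
    approxSqrt n q ℚ.+ ε ℚ.+ ε              ≡⟨ ℚ.+-assoc (approxSqrt n q) ε ε ⟩
    approxSqrt n q ℚ.+ (ε ℚ.+ ε)            ∎

isCommutativeRing : IsCommutativeRing _≃_ _+_ _*_ -_ 0ℝ 1ℝ
isCommutativeRing = record
  { isRing = record
    { +-isAbelianGroup = record
      { isGroup = record
        { isMonoid = record
          { isSemigroup = record
            { isMagma = record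
              { isEquivalence = record
                { refl  = λ {x} → pointwise {x} {x} λ _ → ≡.refl
                ; sym   = λ {x} {y} → ≃-sym {x} {y}
                ; trans = λ {x} {y} {z} → ≃-trans {x} {y} {z}
                }
              ; ∙-cong = λ {x} {x′} {y} {y′} → +-cong-≃ {x} {x′} {y} {y′}
              }
            ; assoc = λ x y z → pointwise {(x + y) + z} {x + (y + z)} λ n → ℚ.+-assoc (seq x n) (seq y n) (seq z n)
            }
          ; identity = (λ x → pointwise {0ℝ + x} {x} λ n → ℚ.+-identityˡ (seq x n))
                     , (λ x → pointwise {x + 0ℝ} {x} λ n → ℚ.+-identityʳ (seq x n))
          }
        ; inverse = (λ x → pointwise { - x + x} {0ℝ} λ n → ℚ.+-inverseˡ (seq x n))
                  , (λ x → pointwise {x + - x} {0ℝ} λ n → ℚ.+-inverseʳ (seq x n))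
        ; ⁻¹-cong = λ {x} {y} → neg-cong-≃ {x} {y}
        }
      ; comm = λ x y → pointwise {x + y} {y + x} λ n → ℚ.+-comm (seq x n) (seq y n)
      }
    ; *-cong = λ {x} {x′} {y} {y′} → *-cong-≃ {x} {x′} {y} {y′}
    ; *-assoc = λ x y z → pointwise {(x * y) * z} {x * (y * z)} λ n → ℚ.*-assoc (seq x n) (seq y n) (seq z n)
    ; *-identity = (λ x → pointwise {1ℝ * x} {x} λ n → ℚ.*-identityˡ (seq x n))
                 , (λ x → pointwise {x * 1ℝ} {x} λ n → ℚ.*-identityʳ (seq x n))
    ; distrib = (λ x y z → pointwise {x * (y + z)} {x * y + x * z} λ n → ℚ.*-distribˡ-+ (seq x n) (seq y n) (seq z n))
              , (λ x y z → pointwise {(y + z) * x} {y * x + z * x} λ n → ℚ.*-distribʳ-+ (seq x n) (seq y n) (seq z n))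
    }
  ; *-comm = λ x y → pointwise {x * y} {y * x} λ n → ℚ.*-comm (seq x n) (seq y n)
  }

ℝ-commutativeRing : CommutativeRing 0ℓ 0ℓ
ℝ-commutativeRing = record { isCommutativeRing = isCommutativeRing }

-- Square roots, apartness from zero and quotients.

-- Termwise, hence stronger than `0ℝ ≤ x` and dependent on the representing sequence. Roots satisfy
-- it by construction, and it lets estimates run at each index.
NonNeg : ℝ → Set
NonNeg x = ∀ n → 0ℚ ℚ.≤ seq x n

√-nonNeg : ∀ x → NonNeg (√ x)
√-nonNeg x n = approxSqrt-nonNeg n (seq x n)

*-nonNeg : ∀ {x y} → NonNeg x → NonNeg y → NonNeg (x * y)
*-nonNeg {x} {y} 0≤x 0≤y n = *-mono-≤ {0ℚ} {seq x n} {0ℚ} {seq y n} ℚ.≤-refl (0≤x n) (0≤x n) (0≤y n)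

-- For p, q ≥ 0 one has |p - q|² ≤ |p - q| (p + q) = |p² - q²|, so squares within ε² force values
-- within ε, with no division by p + q.
square-injective : ∀ {x y} → NonNeg x → NonNeg y → x * x ≃ y * y → x ≃ y
square-injective {x} {y} 0≤x 0≤y x²≃y² ε 0<ε =
  eventually (λ n close → square-cancel-≤ (ℚ.<⇒≤ 0<ε) (ℚ.≤-trans (bound (0≤x n) (0≤y n)) close))
    (x²≃y² (ε ℚ.* ε) (0<* 0<ε 0<ε))
  where
  open ℚ.≤-Reasoning
  open +-*-Solver

  factor : ∀ p q → (p ℚ.- q) ℚ.* (p ℚ.+ q) ≡ p ℚ.* p ℚ.- q ℚ.* q
  factor = solve 2 (λ p q → (p :- q) :* (p :+ q) := p :* p :- q :* q) ≡.refl

  diff≤sum : ∀ {p q} → 0ℚ ℚ.≤ q → p ℚ.- q ℚ.≤ p ℚ.+ q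
  diff≤sum {p} 0≤q = ℚ.+-monoʳ-≤ p (ℚ.≤-trans (ℚ.neg-antimono-≤ 0≤q) 0≤q)

  bound : ∀ {p q} → 0ℚ ℚ.≤ p → 0ℚ ℚ.≤ q →
    ℚ.∣ p ℚ.- q ∣ ℚ.* ℚ.∣ p ℚ.- q ∣ ℚ.≤ ℚ.∣ p ℚ.* p ℚ.- q ℚ.* q ∣
  bound {p} {q} 0≤p 0≤q = begin
    ℚ.∣ p ℚ.- q ∣ ℚ.* ℚ.∣ p ℚ.- q ∣
      ≤⟨ ℚ.*-monoˡ-≤-nonNeg ℚ.∣ p ℚ.- q ∣ {{ℚ.∣-∣-nonNeg (p ℚ.- q)}} (ℚ.≤-trans
           (abs≤ (diff≤sum {p} {q} 0≤q)
             (≡.subst₂ ℚ._≤_ (neg-swap q p) (ℚ.+-comm q p) (diff≤sum {q} {p} 0≤p)))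
           (p≤abs (p ℚ.+ q))) ⟩
    ℚ.∣ p ℚ.- q ∣ ℚ.* ℚ.∣ p ℚ.+ q ∣
      ≡⟨ ℚ.∣p*q∣≡∣p∣*∣q∣ (p ℚ.- q) (p ℚ.+ q) ⟨
    ℚ.∣ (p ℚ.- q) ℚ.* (p ℚ.+ q) ∣
      ≡⟨ ≡.cong ℚ.∣_∣ (factor p q) ⟩
    ℚ.∣ p ℚ.* p ℚ.- q ℚ.* q ∣ ∎

-- With s the root rounded down and w = 1/(1+n), s² ≤ x < (s + w)². The gap x - s² is thus at most
-- (2s + w)w, where |s| ≤ B, w ≤ 1 and eventually w ≤ ε.
√-square : ∀ x → NonNeg x → √ x * √ x ≃ x
√-square x 0≤x with cauchy-bounded (seq (√ x)) (cauchy (√ x))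
... | B , 0<B , s≤B = ≃-up-to {√ x * √ x} {x} (B ℚ.+ (B ℚ.+ 1ℚ)) (0<+ 0<B (0<+ 0<B 0<1)) λ ε 0<ε →
  eventually₂ (λ n s≤B (ε≤n , 1≤n) → abs≤
      (ℚ.≤-trans (≤⇒diff≤ {q = seq x n} (ℚ.≤-trans (lower n) (ℚ.≤-reflexive (≡.sym (ℚ.+-identityʳ (seq x n))))))
        (ℚ.<⇒≤ (0<* (0<+ 0<B (0<+ 0<B 0<1)) 0<ε)))
      (subst (ℚ._≤ _) (neg-swap (seq x n) (s n ℚ.* s n)) (upper n 0<ε s≤B (frac1≤ 0<ε ε≤n) (frac1≤ 0<1 1≤n))))
    s≤B
    (eventually₂ (λ _ → _,_) (↧ₙ ε , λ _ h → h) (↧ₙ 1ℚ , λ _ h → h))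
  where
  open ℚ.≤-Reasoning
  open +-*-Solver

  s : ℕ → ℚ
  s = seq (√ x)

  lower : ∀ n → s n ℚ.* s n ℚ.≤ seq x n
  lower n with approxSqrt-lower n (seq x n)
  -- The value 0 may be the default of `approxSqrt`, so 0² ≤ x has to come from the termwise
  -- nonnegativity of `x`.
  ... | inj₁ s≡0  = subst (λ r → r ℚ.* r ℚ.≤ seq x n) (≡.sym s≡0) (0≤x n)
  ... | inj₂ s²≤x = s²≤x

  square-diff : ∀ p q → (p ℚ.+ q) ℚ.* (p ℚ.+ q) ℚ.- p ℚ.* p ≡ (p ℚ.+ (p ℚ.+ q)) ℚ.* q
  square-diff = solve 2 (λ p q → (p :+ q) :* (p :+ q) :- p :* p := (p :+ (p :+ q)) :* q) ≡.refl

  upper : ∀ n {ε} → 0ℚ ℚ.< ε → ℚ.∣ s n ∣ ℚ.≤ B → frac 1 n ℚ.≤ ε → frac 1 n ℚ.≤ 1ℚ →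
    seq x n ℚ.- s n ℚ.* s n ℚ.≤ (B ℚ.+ (B ℚ.+ 1ℚ)) ℚ.* ε
  upper n {ε} 0<ε ∣s∣≤B w≤ε w≤1 = begin
    seq x n ℚ.- s n ℚ.* s n
      ≤⟨ ℚ.+-monoˡ-≤ (ℚ.- (s n ℚ.* s n)) (ℚ.<⇒≤ (approxSqrt-upper n (seq x n))) ⟩
    (s n ℚ.+ w) ℚ.* (s n ℚ.+ w) ℚ.- s n ℚ.* s n
      ≡⟨ square-diff (s n) w ⟩
    (s n ℚ.+ (s n ℚ.+ w)) ℚ.* w
      ≤⟨ *-mono-≤ (frac-nonNeg 1 n) (ℚ.<⇒≤ (0<+ 0<B (0<+ 0<B 0<1)))
           (ℚ.+-mono-≤ s≤B′ (ℚ.+-mono-≤ s≤B′ w≤1)) w≤ε ⟩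
    (B ℚ.+ (B ℚ.+ 1ℚ)) ℚ.* ε ∎
    where
    w = frac 1 n
    s≤B′ = ℚ.≤-trans (p≤abs (s n)) ∣s∣≤B

-- Eventually |xy| ≥ 1/2 while |y| ≤ B, so |x| ≥ 1/(2B); here `D` is 1/B.
invertible⇒#0 : ∀ {x y} → x * y ≃ 1ℝ → x # 0ℝ
invertible⇒#0 {x} {y} xy≃1 with cauchy-bounded (seq y) (cauchy y)
... | B , 0<B , y≤B with 1/pos 0<B
... | D , 0<D , BD≡1 = ℚ.½ ℚ.* D , 0<* 0<½ 0<D , eventually₂ bound y≤B (xy≃1 ℚ.½ 0<½)
  where
  open ℚ.≤-Reasoning
  0<½ : 0ℚ ℚ.< ℚ.½
  0<½ = ℚ.positive⁻¹ ℚ.½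

  bound : ∀ n → ℚ.∣ seq y n ∣ ℚ.≤ B → ℚ.∣ seq x n ℚ.* seq y n ℚ.- 1ℚ ∣ ℚ.≤ ℚ.½ →
    ℚ.½ ℚ.* D ℚ.≤ ℚ.∣ seq x n ℚ.- 0ℚ ∣
  bound n ∣y∣≤B close = ℚ.*-cancelʳ-≤-pos B {{ℚ.positive 0<B}} $ begin
    ℚ.½ ℚ.* D ℚ.* B          ≡⟨ ℚ.*-assoc ℚ.½ D B ⟩
    ℚ.½ ℚ.* (D ℚ.* B)        ≡⟨ ≡.cong (ℚ.½ ℚ.*_) (≡.trans (ℚ.*-comm D B) BD≡1) ⟩
    ℚ.½                      ≤⟨ ≤⇒diff≤ {1ℚ} {ℚ.½} (subst (1ℚ ℚ.≤_) (ℚ.+-comm (p ℚ.* q) ℚ.½)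
                                  (diff≤⇒≤ {1ℚ} {p ℚ.* q} (ℚ.≤-trans (p≤abs (1ℚ ℚ.- p ℚ.* q))
                                    (subst (ℚ._≤ ℚ.½) (abs-swap (p ℚ.* q) 1ℚ) close)))) ⟩
    p ℚ.* q                  ≤⟨ p≤abs (p ℚ.* q) ⟩
    ℚ.∣ p ℚ.* q ∣            ≡⟨ ℚ.∣p*q∣≡∣p∣*∣q∣ p q ⟩
    ℚ.∣ p ∣ ℚ.* ℚ.∣ q ∣      ≤⟨ ℚ.*-monoˡ-≤-nonNeg ℚ.∣ p ∣ {{ℚ.∣-∣-nonNeg p}} ∣y∣≤B ⟩
    ℚ.∣ p ∣ ℚ.* B            ≡⟨ ≡.cong (λ r → ℚ.∣ r ∣ ℚ.* B) (minus-zero p) ⟨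
    ℚ.∣ p ℚ.- 0ℚ ∣ ℚ.* B     ∎
    where
    p = seq x n
    q = seq y n

*⇒/ : ∀ {x y z} (y#0 : y # 0ℝ) → x ≃ z * y → (x / y) {{y#0}} ≃ z
*⇒/ {x} {y} {z} y#0@(e , 0<e , e≤y) x≃zy = begin
  x * 1/y          ≈⟨ R.*-congʳ {1/y} {x} {z * y} x≃zy ⟩
  z * y * 1/y      ≈⟨ R.*-assoc z y 1/y ⟩
  z * (y * 1/y)    ≈⟨ R.*-congˡ {z} {y * 1/y} {1ℝ} inverse ⟩
  z * 1ℝ           ≈⟨ R.*-identityʳ z ⟩
  z                ∎
  where
  module R = CommutativeRing ℝ-commutativeRing
  open import Relation.Binary.Reasoning.Setoid R.setoid
  1/y : ℝ
  1/y = mkℝ (λ n → recip (seq y n)) (recip-cauchy (seq y) (cauchy y) y#0)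
  inverse : y * 1/y ≃ 1ℝ
  -- `recip` sends 0 to 0, so the product is 1 only at indices where the apartness bound `e`
  -- excludes a zero term.
  inverse ε 0<ε = eventually (λ n e≤∣y∣ → abs≡ (≡.trans (ℚ.*-comm (seq y n) (recip (seq y n)))
    (recip-inverse (seq y n) 0<e (subst (λ p → e ℚ.≤ ℚ.∣ p ∣) (minus-zero (seq y n)) e≤∣y∣))) (ℚ.<⇒≤ 0<ε)) e≤y

-- A nonpositive term lies at distance at least 1 from 1, against a tolerance of 1/2. This separates
-- coordinates of distinct points.
≤0⇒≄1 : ∀ {x} → (∀ n → seq x n ℚ.≤ 0ℚ) → ¬ x ≃ 1ℝ
≤0⇒≄1 {x} x≤0 x≃1 with x≃1 ℚ.½ (ℚ.positive⁻¹ ℚ.½)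
... | N , close = ℚ.<-irrefl ≡.refl (ℚ.<-≤-trans ½<1 bound)
  where
  open ℚ.≤-Reasoning
  ½<1 : ℚ.½ ℚ.< 1ℚ
  ½<1 = from-yes (ℚ.½ ℚ.<? 1ℚ)
  bound : 1ℚ ℚ.≤ ℚ.½
  bound = begin
    1ℚ                        ≤⟨ ℚ.+-monoʳ-≤ 1ℚ (ℚ.neg-antimono-≤ (x≤0 N)) ⟩
    1ℚ ℚ.- seq x N            ≤⟨ p≤abs (1ℚ ℚ.- seq x N) ⟩
    ℚ.∣ 1ℚ ℚ.- seq x N ∣      ≡⟨ abs-swap 1ℚ (seq x N) ⟩
    ℚ.∣ seq x N ℚ.- 1ℚ ∣      ≤⟨ close N ℕ.≤-refl ⟩
    ℚ.½                       ∎

-- Finite subsets and initial segments.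

elements-injective : ∀ {n} (S : Subset n) → Injective _≡_ _≡_ (elements S)
elements-injective (inside  ∷ S) {zero}  {zero}  _  = ≡.refl
elements-injective (inside  ∷ S) {suc a} {suc b} eq = ≡.cong suc (elements-injective S (suc-injective eq))
elements-injective (outside ∷ S)                 eq = elements-injective S (suc-injective eq)

∣∪⁅⁆∣ : ∀ {n} (C : Subset n) {q} → q ∉ C → card (C ∪ ⁅ q ⁆) ≡ suc (card C)
∣∪⁅⁆∣ (inside  ∷ C) {zero}  q∉C = contradiction here q∉C
∣∪⁅⁆∣ (outside ∷ C) {zero}  q∉C = ≡.cong (suc ∘ card) (∪-identityʳ C)
∣∪⁅⁆∣ (inside  ∷ C) {suc q} q∉C = ≡.cong suc (∣∪⁅⁆∣ C (q∉C ∘ there))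
∣∪⁅⁆∣ (outside ∷ C) {suc q} q∉C = ∣∪⁅⁆∣ C (q∉C ∘ there)

-- The greedy set after `toℕ i` steps. The index ranges over `Fin (suc n)` so that both the empty
-- and the full set occur.
below : ∀ {n} → Fin (suc n) → Subset n
below         zero    = ⊥
below {suc n} (suc i) = inside ∷ below i

below-suc : ∀ {n} (i : Fin n) → below (inject₁ i) ∪ ⁅ i ⁆ ≡ below (suc i)
below-suc {suc n} zero    = ≡.cong (inside ∷_) (∪-identityˡ ⊥)
below-suc {suc n} (suc i) = ≡.cong (inside ∷_) (below-suc i)

i∉below-i : ∀ {n} (i : Fin n) → i ∉ below (inject₁ i)
i∉below-i zero    ()
i∉below-i (suc i) (there i∈) = i∉below-i i i∈

-- Identifies the greedy set after k steps with the form in which `V` is stated.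
below-last : ∀ k → below (inject₁ (fromℕ k)) ≡ ⊤ - fromℕ k
below-last zero    = ≡.refl
below-last (suc k) = ≡.cong (inside ∷_) (below-last k)

∣⊤-last∣ : ∀ m → card (⊤ - fromℕ m) ≡ m
∣⊤-last∣ zero    = ≡.refl
∣⊤-last∣ (suc m) = ≡.cong suc (∣⊤-last∣ m)

-- Natural numbers and their multiples in the reals.

·-fromℚ : ∀ n p → n · fromℚ p ≃ fromℚ (ι n ℚ.* p)
·-fromℚ n p = pointwise {n · fromℚ p} {fromℚ (ι n ℚ.* p)} λ i → go i n
  where
  open ≡.≡-Reasoning
  go : ∀ i n → seq (n · fromℚ p) i ≡ ι n ℚ.* p
  go i zero    = ≡.sym (≡.trans (≡.cong (ℚ._* p) (frac-zero 0)) (ℚ.*-zeroˡ p))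
  go i (suc n) = begin
    p ℚ.+ seq (n · fromℚ p) i      ≡⟨ ≡.cong (p ℚ.+_) (go i n) ⟩
    p ℚ.+ ι n ℚ.* p                ≡⟨ ℚ.+-comm p _ ⟩
    ι n ℚ.* p ℚ.+ p                ≡⟨ ≡.cong (ι n ℚ.* p ℚ.+_) (ℚ.*-identityˡ p) ⟨
    ι n ℚ.* p ℚ.+ 1ℚ ℚ.* p         ≡⟨ ℚ.*-distribʳ-+ p (ι n) 1ℚ ⟨
    (ι n ℚ.+ 1ℚ) ℚ.* p             ≡⟨ ≡.cong (ℚ._* p) (ι-suc n) ⟨
    ι (suc n) ℚ.* p                ∎

opaque
  unfolding frac
  -- Both sides are the constant sequence `+ n / 1` once `frac` is unfolded.
  fromℕ→ℝ≃fromℚ∘ι : ∀ n → fromℕ→ℝ n ≃ fromℚ (ι n)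
  fromℕ→ℝ≃fromℚ∘ι n = pointwise {fromℕ→ℝ n} {fromℚ (ι n)} λ _ → ≡.refl

-- The point set.

-- Here k is suc m.
module Construction (m : ℕ) where
  open CommutativeRing ℝ-commutativeRing using (setoid; reflexive; sym; trans; *-comm; *-cong; *-congˡ)
  open ArrowDeterminant ℝ-commutativeRing
  open import Algebra.Properties.CommutativeMonoid.Mult (CommutativeRing.+-commutativeMonoid ℝ-commutativeRing) using (×-congʳ)
  module ≃-Reasoning = SetoidReasoning setoid

  1/k : ℝ
  1/k = fromℚ (frac 1 m)

  t : ℝ
  t = - √ 1/k

  v : Vector (Point (suc m)) (suc (suc m))
  v zero    = λ _ → t
  v (suc j) = δ j

  t²≃1/k : t * t ≃ 1/k
  t²≃1/k = trans {t * t} {√ 1/k * √ 1/k} {1/k} (-x*-x≈x*x (√ 1/k)) (√-square 1/k λ _ → frac-nonNeg 1 m)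

  ι-k*1/k≡1 : ι (suc m) ℚ.* frac 1 m ≡ 1ℚ
  ι-k*1/k≡1 = ≡.trans (ℚ.*-comm (ι (suc m)) (frac 1 m)) (≡.trans (frac-*-ι 1 m) ι1≡1)

  kt²≃1 : suc m · (t * t) ≃ 1ℝ
  kt²≃1 = begin
    suc m · (t * t)                     ≈⟨ ×-congʳ (suc m) {t * t} {1/k} t²≃1/k ⟩
    suc m · 1/k                         ≈⟨ ·-fromℚ (suc m) (frac 1 m) ⟩
    fromℚ (ι (suc m) ℚ.* frac 1 m)      ≈⟨ pointwise {fromℚ (ι (suc m) ℚ.* frac 1 m)} {1ℝ} (λ _ → ι-k*1/k≡1) ⟩
    1ℝ                                  ∎
    where open ≃-Reasoning

  -- Volumes of subsets and the greedy run.

  vol-outside : ∀ T → vol v (outside ∷ T) ≃ √ 1ℝ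
  vol-outside T = √-cong {det (gram (v ∘ elements (outside ∷ T)))} {1ℝ}
    (det-gram-basis (elements T) (elements-injective T))

  -- The value depends on `T` only through its cardinality, which is what makes the later greedy
  -- steps ties.
  vol-inside : ∀ T → vol v (inside ∷ T) ≃ √ (1ℝ + card T · (- (t * t)))
  vol-inside T = √-cong {det (gram (v ∘ elements (inside ∷ T)))} {1ℝ + card T · (- (t * t))}
    (det-gram-diagonal-vector (elements T) (elements-injective T) (v ∘ elements (inside ∷ T))
      (λ _ → ≡.refl) (λ _ _ → ≡.refl) kt²≃1)

  -- Assuming `card T ≡ 0` lets this apply to `⊥ ∪ ⊥`, the tail of `⊥ ∪ ⁅ zero ⁆`.
  vol-singleton : ∀ T → card T ≡ 0 → vol v (inside ∷ T) ≃ √ 1ℝ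
  vol-singleton T ∣T∣≡0 = trans {vol v (inside ∷ T)} {√ (1ℝ + card T · (- (t * t)))} {√ 1ℝ} (vol-inside T)
    (√-cong {1ℝ + card T · (- (t * t))} {1ℝ} (subst (λ n → 1ℝ + n · (- (t * t)) ≃ 1ℝ) (≡.sym ∣T∣≡0)
      (pointwise {1ℝ + 0ℝ} {1ℝ} λ _ → ℚ.+-identityʳ 1ℚ)))

  -- At `zero` each candidate is a single unit vector. At `suc i` both sets contain v₁ and equally
  -- many basis vectors, so `vol-inside` gives them the same volume.
  tie : ∀ i {q} → q ∉ below (inject₁ i) → vol v (below (inject₁ i) ∪ ⁅ q ⁆) ≃ vol v (below (inject₁ i) ∪ ⁅ i ⁆)
  tie zero {q} _ = trans {vol v (⊥ ∪ ⁅ q ⁆)} {√ 1ℝ} {vol v (⊥ ∪ ⁅ zero ⁆)}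
    (vol-first q) (sym {vol v (⊥ ∪ ⁅ zero ⁆)} {√ 1ℝ} (vol-first zero))
    where
    vol-first : ∀ q → vol v (⊥ ∪ ⁅ q ⁆) ≃ √ 1ℝ
    vol-first zero    = vol-singleton (⊥ ∪ ⊥) (≡.trans (≡.cong card (∪-identityˡ (⊥ {n = suc m}))) (∣⊥∣≡0 (suc m)))
    vol-first (suc q) = vol-outside (⊥ ∪ ⁅ q ⁆)
  tie (suc i) {zero}  q∉C = contradiction here q∉C
  tie (suc i) {suc q} q∉C = subst (λ n → vol v (inside ∷ S) ≃ √ (1ℝ + n · (- (t * t)))) ∣S∣≡∣T∣ (vol-inside S)
    ⟨trans⟩ sym {vol v (inside ∷ T)} {√ (1ℝ + card T · (- (t * t)))} (vol-inside T)
    where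
    C = below (inject₁ i)
    S = C ∪ ⁅ q ⁆
    T = C ∪ ⁅ i ⁆
    _⟨trans⟩_ = trans {vol v (inside ∷ S)} {√ (1ℝ + card T · (- (t * t)))} {vol v (inside ∷ T)}
    ∣S∣≡∣T∣ : card S ≡ card T
    ∣S∣≡∣T∣ = ≡.trans (∣∪⁅⁆∣ C (q∉C ∘ there)) (≡.sym (∣∪⁅⁆∣ C (i∉below-i i)))

  -- Ties are broken towards the least index not yet chosen; `tie` turns maximality into an
  -- equality.
  greedy-below : ∀ i → Greedy v (toℕ i) (below i)
  greedy-below = <-weakInduction (λ i → Greedy v (toℕ i) (below i)) start λ i g →
    subst₂ (Greedy v) (≡.cong suc (toℕ-inject₁ i)) (below-suc i)
      (step g (i∉below-i i) λ q q∉C →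
        ≃⇒≤ {vol v (below (inject₁ i) ∪ ⁅ q ⁆)} {vol v (below (inject₁ i) ∪ ⁅ i ⁆)} (tie i q∉C))

  greedy : Greedy v (suc m) (⊤ - fromℕ (suc m))
  greedy = subst₂ (Greedy v) (≡.trans (toℕ-inject₁ (fromℕ (suc m))) (toℕ-fromℕ (suc m))) (below-last (suc m))
    (greedy-below (inject₁ (fromℕ (suc m))))

  -- A basis vector has a coordinate equal to 1; there v₁ has the termwise nonpositive `t`, and any
  -- other basis vector has 0.
  v-injective : Injective _≡_ _≈_ v
  v-injective {zero}  {zero}  _     = ≡.refl
  v-injective {zero}  {suc j} v≈v  = contradiction
    (trans {t} {δ j j} {1ℝ} (v≈v j) (reflexive (δ-diagonal j))) t≄1
    where
    t≄1 : ¬ t ≃ 1ℝ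
    t≄1 = ≤0⇒≄1 {t} λ n → ℚ.neg-antimono-≤ (√-nonNeg 1/k n)
  v-injective {suc i} {zero}  v≈v  = ≡.sym (v-injective {zero} {suc i} λ l → sym {δ i l} {t} (v≈v l))
  v-injective {suc i} {suc j} v≈v  with i ≟ j
  ... | yes ≡.refl = ≡.refl
  ... | no i≢j = contradiction (subst₂ _≃_ (δ-off-diagonal i≢j) (δ-diagonal j) (v≈v j)) (≤0⇒≄1 {0ℝ} λ _ → ℚ.≤-refl)

  -- The volume ratio.

  V W : Subset (suc (suc m))
  V = ⊤ - fromℕ (suc m)
  W = (V - zero) ∪ ⁅ fromℕ (suc m) ⁆

  -- `V` consists of v₁ and k - 1 = m basis vectors, so its Gram determinant is 1 - (k - 1)t² = t² =
  -- 1/k.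
  vol-V : vol v V ≃ √ 1/k
  vol-V = begin
    vol v V                                ≈⟨ vol-inside (⊤ - fromℕ m) ⟩
    √ (1ℝ + card (⊤ - fromℕ m) · (- (t * t)))  ≡⟨ ≡.cong (λ n → √ (1ℝ + n · (- (t * t)))) (∣⊤-last∣ m) ⟩
    √ (1ℝ + m · (- (t * t)))               ≈⟨ √-cong {1ℝ + m · (- (t * t))} {t * t} (1+m·-x≈x m (t * t) kt²≃1) ⟩
    √ (t * t)                              ≈⟨ √-cong {t * t} {1/k} t²≃1/k ⟩
    √ 1/k                                  ∎
    where open ≃-Reasoning

  √k : ℝ
  √k = √ fromℕ→ℝ (suc m)

  -- Both sides are termwise nonnegative, so comparing squares suffices, and these reduce to k ·
  -- (1/k) = 1 · 1.
  √k*√1/k≃1 : √k * √ 1/k ≃ 1ℝ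
  √k*√1/k≃1 = square-injective {√k * √ 1/k} {1ℝ}
    (*-nonNeg {√k} {√ 1/k} (√-nonNeg (fromℕ→ℝ (suc m))) (√-nonNeg 1/k)) (λ _ → ℚ.<⇒≤ 0<1) (begin
    (√k * √ 1/k) * (√k * √ 1/k)
      ≈⟨ pointwise {(√k * √ 1/k) * (√k * √ 1/k)} {(√k * √k) * (√ 1/k * √ 1/k)}
           (λ n → mul-interchange (seq √k n) (seq (√ 1/k) n) (seq √k n) (seq (√ 1/k) n)) ⟩
    (√k * √k) * (√ 1/k * √ 1/k)
      ≈⟨ *-cong {√k * √k} {fromℚ (ι (suc m))} {√ 1/k * √ 1/k} {1/k} √k²≃k (√-square 1/k λ _ → frac-nonNeg 1 m) ⟩
    fromℚ (ι (suc m)) * 1/k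
      ≈⟨ pointwise {fromℚ (ι (suc m)) * 1/k} {1ℝ * 1ℝ} (λ _ → ι-k*1/k≡1) ⟩
    1ℝ * 1ℝ ∎)
    where
    open ≃-Reasoning
    -- Passing to `ι` gives access to the facts about `frac`, among them the nonnegativity that
    -- `√-square` asks for.
    √k≃ : √k ≃ √ fromℚ (ι (suc m))
    √k≃ = √-cong {fromℕ→ℝ (suc m)} {fromℚ (ι (suc m))} (fromℕ→ℝ≃fromℚ∘ι (suc m))
    √k²≃k : √k * √k ≃ fromℚ (ι (suc m))
    √k²≃k = trans {√k * √k} {√ fromℚ (ι (suc m)) * √ fromℚ (ι (suc m))} {fromℚ (ι (suc m))}
      (*-cong {√k} {√ fromℚ (ι (suc m))} {√k} {√ fromℚ (ι (suc m))} √k≃ √k≃)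
      (√-square (fromℚ (ι (suc m))) λ _ → 0≤ι (suc m))

  vol-W : vol v W ≃ 1ℝ
  -- `W` computes to `outside ∷ tail W`: index `zero` is removed and the added index is a successor.
  vol-W = trans {vol v W} {√ 1ℝ} {1ℝ} (vol-outside (tail W))
    (square-injective {√ 1ℝ} {1ℝ} (√-nonNeg 1ℝ) (λ _ → ℚ.<⇒≤ 0<1)
      (trans {√ 1ℝ * √ 1ℝ} {1ℝ} {1ℝ * 1ℝ} (√-square 1ℝ λ _ → ℚ.<⇒≤ 0<1) (pointwise {1ℝ} {1ℝ * 1ℝ} λ _ → ≡.refl)))

  -- Serves twice: an inverse makes the volume of `V` apart from 0, and the same equation yields the
  -- quotient.
  √k*vol-V≃1 : √k * vol v V ≃ 1ℝ
  √k*vol-V≃1 = trans {√k * vol v V} {√k * √ 1/k} {1ℝ}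
    (*-congˡ {√k} {vol v V} {√ 1/k} vol-V) √k*√1/k≃1

  vol-V#0 : vol v V # 0ℝ
  vol-V#0 = invertible⇒#0 {vol v V} {√k}
    (trans {vol v V * √k} {√k * vol v V} {1ℝ} (*-comm (vol v V) √k) √k*vol-V≃1)

  ratio : (vol v W / vol v V) {{vol-V#0}} ≃ √k
  ratio = *⇒/ {vol v W} {vol v V} {√k} vol-V#0
    (trans {vol v W} {1ℝ} {√k * vol v V} vol-W (sym {√k * vol v V} {1ℝ} √k*vol-V≃1))

theorem9 : ∀ k → .{{_ : NonZero k}} →
    Σ ℕ λ d → Σ (Vector (Point d) (suc k)) λ v →
      let V = ⊤ - fromℕ k
          W = (V - zero) ∪ ⁅ fromℕ k ⁆
      in Injective _≡_ _≈_ v ×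
         Greedy v k V ×
         Σ (vol v V # 0ℝ) λ V≠0 →
           (vol v W / vol v V) {{V≠0}} ≃ √ fromℕ→ℝ k
theorem9 (suc m) = suc m , v , v-injective , greedy , vol-V#0 , ratio
  where open Construction m
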